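{- The problem $k$-DOMINATING SET restricted to co-3-track interval graphs (complements of 3-track interval graphs) is W[1]-hard with parameter $k$.
   Context: A dominating set of a graph $H$ is a set $D$ of vertices such that every vertex of $H$ is in $D$ or adjacent to a vertex of $D$. $k$-DOMINATING SET: given a graph $H$ and an integer $k$, decide whether $H$ has a dominating set of $k$ vertices. The intersection graph of a family of sets has one vertex per member, two different members being adjacent iff they intersect; the family is a representation of the graph. A 3-track interval is the union of three intervals on three disjoint parallel lines (tracks), one interval on each track. A 3-track interval graph is the intersection graph of a family of 3-track intervals, and a co-3-track interval graph is the complement of such a graph. A multiple-interval representation (of the 3-track interval graph whose complement is $H$) is given as part of the input. A parameterized problem is W[1]-hard if every problem in W[1] has an FPT reduction to it; equivalently, if $k$-CLIQUE in general graphs (parameter $k$) has an FPT reduction to it. An FPT reduction maps an instance $(x,k)$ to an equivalent instance $(x',k')$ in time $g(k)\cdot|x|^{O(1)}$ with $k'\le h(k)$, for computable functions $g,h$. -}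

module Defs where

open import Data.Bool using (Bool; true; false; T; not; _∧_)
open import Data.Fin using (Fin; _≟_)
open import Data.Fin.Properties using (any?)
open import Data.Fin.Subset using (Subset; _∈_; ∣_∣)
open import Data.List using (List; []; _∷_; _++_; concat; length; replicate; tabulate)
open import Data.Nat using (ℕ; suc; _+_; _*_; _^_; _⊔_; _≤_; _≤?_)
open import Data.Nat.Properties using (≤-trans; ⊔-lub; m≤m⊔n; m≤n⊔m)
open import Data.Product using (Σ-syntax; ∃-syntax; _×_; _,_)
open import Data.Sum using (_⊎_)
open import Data.Vec as Vec using (Vec; lookup; _[_]≔_)
open import Function.Bundles using (_⇔_; mk⇔)
open import Relation.Binary.PropositionalEquality
  using (_≡_; _≢_; refl; sym; cong; cong₂)
open import Relation.Nullary.Decidable using (Dec; does; yes; no; map′; _×-dec_; dec-true; does-⇔)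
open import Relation.Nullary.Negation using (contradiction)

record Graph (n : ℕ) : Set where
  field
    adj        : Fin n → Fin n → Bool
    adj-sym    : ∀ u v → adj u v ≡ adj v u
    adj-irrefl : ∀ u → adj u u ≡ false

  Adj : Fin n → Fin n → Set
  Adj u v = T (adj u v)

open Graph public

distinct : ∀ {n} → Fin n → Fin n → Bool
distinct u v = not (does (u ≟ v))

distinct-sym : ∀ {n} (u v : Fin n) → distinct u v ≡ distinct v u
distinct-sym u v with u ≟ v | v ≟ u
... | yes _   | yes _   = refl
... | no _    | no _    = refl
... | yes u≡v | no v≢u  = contradiction (sym u≡v) v≢u
... | no u≢v  | yes v≡u = contradiction (sym v≡u) u≢v

distinct-irrefl : ∀ {n} (u : Fin n) → distinct u u ≡ false
distinct-irrefl u = cong not (dec-true (u ≟ u) refl)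

complement : ∀ {n} → Graph n → Graph n
complement G .adj u v = distinct u v ∧ not (adj G u v)
complement G .adj-sym u v = cong₂ _∧_ (distinct-sym u v) (cong not (adj-sym G u v))
complement G .adj-irrefl u = cong (_∧ not (adj G u u)) (distinct-irrefl u)

IsClique : ∀ {n} → Graph n → Subset n → Set
IsClique G S = ∀ u v → u ∈ S → v ∈ S → u ≢ v → Adj G u v

IsDominating : ∀ {n} → Graph n → Subset n → Set
IsDominating G D = ∀ v → v ∈ D ⊎ (∃[ u ] u ∈ D × Adj G v u)

-- Closed intervals with natural-number endpoints, on lines whose points are
-- the natural numbers.  Every finite family of real intervals can be
-- normalised to this form without changing which members intersect, and two
-- real intervals with natural endpoints meet iff they share a natural number.
record Interval : Set where
  field
    lo hi : ℕ
    lo≤hi : lo ≤ hi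

open Interval public

Tracks : ℕ
Tracks = 3

Point : Set
Point = Fin Tracks × ℕ

ThreeTrackInterval : Set
ThreeTrackInterval = Fin Tracks → Interval

_∈ᵢ_ : Point → ThreeTrackInterval → Set
(t , x) ∈ᵢ I = lo (I t) ≤ x × x ≤ hi (I t)

Intersects : ThreeTrackInterval → ThreeTrackInterval → Set
Intersects I J = ∃[ p ] p ∈ᵢ I × p ∈ᵢ J

intersects? : ∀ I J → Dec (Intersects I J)
intersects? I J =
  map′ to from (any? λ t → (lo (I t) ≤? hi (J t)) ×-dec (lo (J t) ≤? hi (I t)))
  where
  to : (∃[ t ] lo (I t) ≤ hi (J t) × lo (J t) ≤ hi (I t)) → Intersects I J
  to (t , a , b) =
    (t , lo (I t) ⊔ lo (J t)) ,
    (m≤m⊔n _ _ , ⊔-lub (lo≤hi (I t)) b) ,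
    (m≤n⊔m _ _ , ⊔-lub a (lo≤hi (J t)))

  from : Intersects I J → ∃[ t ] lo (I t) ≤ hi (J t) × lo (J t) ≤ hi (I t)
  from ((t , _) , (a , b) , (c , d)) = t , ≤-trans a d , ≤-trans c b

Intersects-sym : ∀ I J → Intersects I J → Intersects J I
Intersects-sym _ _ (p , p∈I , p∈J) = p , p∈J , p∈I

intersectionGraph : ∀ {n} → (Fin n → ThreeTrackInterval) → Graph n
intersectionGraph F .adj u v = distinct u v ∧ does (intersects? (F u) (F v))
intersectionGraph F .adj-sym u v =
  cong₂ _∧_ (distinct-sym u v)
    (does-⇔ (mk⇔ (Intersects-sym (F u) (F v)) (Intersects-sym (F v) (F u)))
            (intersects? (F u) (F v)) (intersects? (F v) (F u)))
intersectionGraph F .adj-irrefl u =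
  cong (_∧ does (intersects? (F u) (F u))) (distinct-irrefl u)

Co3TrackRepresentation : ∀ {n} → Graph n → (Fin n → ThreeTrackInterval) → Set
Co3TrackRepresentation H F =
  ∀ u v → adj H u v ≡ adj (complement (intersectionGraph F)) u v

data Symbol : Set where
  bit : Bool → Symbol
  sep : Symbol

Word : Set
Word = List Symbol

-- Programs over m stacks of symbols.  A Turing-machine tape is a pair of
-- stacks and a finite control can be kept on a further stack, so such programs
-- and multitape Turing machines simulate each other with constant-factor
-- overhead.
data Program (m : ℕ) : Set where
  skip  : Program m
  push  : Fin m → Symbol → Program m
  _⨾_   : Program m → Program m → Program m
  -- `pop r p q` runs p if stack r is empty; otherwise it removes the top
  -- symbol s of stack r and runs q s.
  pop   : Fin m → Program m → (Symbol → Program m) → Program m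
  -- `while r p` repeats p as long as stack r is nonempty.
  while : Fin m → Program m → Program m

infixr 5 _⨾_

State : ℕ → Set
State m = Vec Word m

-- `Run p σ σ′ t`: started in σ, the program p halts in σ′ after t steps.
data Run {m : ℕ} : Program m → State m → State m → ℕ → Set where
  run-skip : ∀ {σ} → Run skip σ σ 1
  run-push : ∀ {r s σ} → Run (push r s) σ (σ [ r ]≔ (s ∷ lookup σ r)) 1
  run-⨾    : ∀ {p q σ σ₁ σ₂ t₁ t₂} →
             Run p σ σ₁ t₁ → Run q σ₁ σ₂ t₂ → Run (p ⨾ q) σ σ₂ (t₁ + t₂)
  run-pop-empty : ∀ {r p q σ σ′ t} → lookup σ r ≡ [] →
             Run p σ σ′ t → Run (pop r p q) σ σ′ (suc t)
  run-pop-nonempty : ∀ {r p q σ σ′ s w t} → lookup σ r ≡ s ∷ w →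
             Run (q s) (σ [ r ]≔ w) σ′ t → Run (pop r p q) σ σ′ (suc t)
  run-while-empty : ∀ {r p σ} → lookup σ r ≡ [] → Run (while r p) σ σ 1
  run-while-nonempty : ∀ {r p σ σ₁ σ₂ s w t₁ t₂} → lookup σ r ≡ s ∷ w →
             Run p σ σ₁ t₁ → Run (while r p) σ₁ σ₂ t₂ →
             Run (while r p) σ σ₂ (suc (t₁ + t₂))

-- Input and output are on stack zero; the other stacks start empty and may
-- contain anything at the end.
Outputs : ∀ {m} → Program (suc m) → Word → Word → ℕ → Set
Outputs {m} p w w′ t =
  Σ[ σ ∈ State m ] Run p (w Vec.∷ Vec.replicate m []) (w′ Vec.∷ σ) t

-- Self-delimiting, so that concatenations of encodings can be decoded.
unary : ℕ → Word
unary n = replicate n (bit true) ++ sep ∷ []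

Computable : (ℕ → ℕ) → Set
Computable f =
  ∃[ m ] Σ[ p ∈ Program (suc m) ] ∀ n → ∃[ t ] Outputs p (unary n) (unary (f n)) t

record ParameterizedProblem : Set₁ where
  field
    Instance : Set
    Yes      : Instance → Set
    param    : Instance → ℕ
    encode   : Instance → Word

  size : Instance → ℕ
  size x = length (encode x)

record FPTReduction (P Q : ParameterizedProblem) : Set where
  private
    module P = ParameterizedProblem P
    module Q = ParameterizedProblem Q
  field
    reduce       : P.Instance → Q.Instance
    equivalent   : ∀ x → P.Yes x ⇔ Q.Yes (reduce x)
    h            : ℕ → ℕ
    h-computable : Computable h
    param-bound  : ∀ x → Q.param (reduce x) ≤ h (P.param x)
    g            : ℕ → ℕ
    g-computable : Computable g
    exponent     : ℕ
    stacks       : ℕ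
    program      : Program (suc stacks)
    runs         : ∀ x → ∃[ t ] t ≤ g (P.param x) * P.size x ^ exponent
                              × Outputs program (P.encode x) (Q.encode (reduce x)) t

-- All numbers are written in unary.  Vertex counts are dominated by the
-- adjacency matrix anyway, the parameter may be written in unary in an FPT
-- reduction, and interval endpoints can be taken linear in the number of
-- intervals, so a binary encoding gives the same notion of hardness.

encodeGraph : ∀ {n} → Graph n → Word
encodeGraph {n} G =
  unary n ++ concat (tabulate λ u → tabulate λ v → bit (adj G u v))

encodeInterval : Interval → Word
encodeInterval I = unary (lo I) ++ unary (hi I)

encodeThreeTrackInterval : ThreeTrackInterval → Word
encodeThreeTrackInterval I = concat (tabulate λ t → encodeInterval (I t))

record CliqueInstance : Set where
  field
    {order} : ℕ
    graph   : Graph order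
    k       : ℕ

k-Clique : ParameterizedProblem
k-Clique = record
  { Instance = CliqueInstance
  ; Yes      = λ x → let open CliqueInstance x in
                 ∃[ S ] ∣ S ∣ ≡ k × IsClique graph S
  ; param    = CliqueInstance.k
  ; encode   = λ x → let open CliqueInstance x in
                 unary k ++ encodeGraph graph
  }

record Co3TrackInstance : Set where
  field
    {order}        : ℕ
    graph          : Graph order
    representation : Fin order → ThreeTrackInterval
    represents     : Co3TrackRepresentation graph representation
    k              : ℕ

k-DominatingSet-Co3Track : ParameterizedProblem
k-DominatingSet-Co3Track = record
  { Instance = Co3TrackInstance
  ; Yes      = λ x → let open Co3TrackInstance x in
                 ∃[ D ] ∣ D ∣ ≡ k × IsDominating graph D
  ; param    = Co3TrackInstance.k
  ; encode   = λ x → let open Co3TrackInstance x in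
                 unary k ++ encodeGraph graph ++
                 concat (tabulate λ v → encodeThreeTrackInterval (representation v))
  }

-- W[1]-hardness in its equivalent form via the W[1]-complete problem k-Clique.
W[1]-Hard : ParameterizedProblem → Set
W[1]-Hard Q = FPTReduction k-Clique Q

{-# OPTIONS --safe #-}

-- The reduction puts 2 k blocks of points on a line, block 2 i + h consisting of
-- the points (i , h , a) for the n vertices a, and draws the same line on all
-- three tracks.  The complement of two gaps on the line is a 3-track interval,
-- and in the complement graph it is dominated exactly by the points in its gaps.
-- One kind of gap vertices forces the 2 k elements of a dominating set to be one
-- point (i , 0 , a) and one point (i , 1 , a′) with a ≤ a′ for each i; another
-- kind, indexed by i < j and nonadjacent u and v, is undominated iff
-- a ≤ u ≤ a′ holds for i and likewise for j and v.  Hence the vertices a chosen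
-- for the different i form a clique, and a clique is turned into a dominating
-- set by taking a = a′.  For each i there are also dominating sets in which gap
-- vertices replace points, but these leave some u undetected in the same way.
--
-- The output is printed by nested loops over expressions in +, *, ∸ and lookup in
-- the input matrix.  Each loop bound is polynomial in the loop variables, so
-- that a compiled program runs in time s ^ d, where d depends on the program only.

module Submission where

open import Defs

open import Data.Bool using (Bool; true; false; not; _∧_; T)
open import Data.Fin using (Fin; zero; suc; toℕ; fromℕ; inject₁; combine; remQuot; splitAt; _↑ˡ_; _↑ʳ_)
open import Data.Fin.Properties
  using (any?; toℕ-injective; toℕ<n; toℕ-fromℕ; toℕ-inject₁; injective⇒≤;
         remQuot-combine; combine-remQuot; splitAt-↑ˡ; splitAt-↑ʳ)
  renaming (suc-injective to Fin-suc-injective)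
open import Data.Fin.Subset using (Subset; _∈_; ∣_∣; inside; outside)
open import Data.Fin.Subset.Properties using (∣p∣≤n)
open import Data.List using ([]; _∷_; _++_; _ʳ++_; concat; length; replicate; tabulate)
open import Data.List.Properties
  using (++-assoc; ++-identityʳ; length-++; length-replicate; length-reverse; reverse-involutive; tabulate-cong)
open import Data.Nat
open import Data.Nat.Properties
open import Data.Nat.Solver using (module +-*-Solver)
open import Data.Product using (Σ-syntax; ∃-syntax; _×_; _,_; proj₁; proj₂)
open import Data.Sum using (_⊎_; inj₁; inj₂; [_,_]′)
open import Data.Unit using (⊤; tt)
open import Data.Vec as Vec using (Vec; lookup; _[_]≔_; here; there)
open import Data.Vec.Properties
  using (lookup-map; map-[]≔; map-replicate; []≔-idempotent; []≔-lookup; lookup∘update;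
         lookup⇒[]=; []=⇒lookup; lookup∘tabulate)
open import Function using (_∘_; id)
open import Function.Bundles using (mk⇔)
open import Relation.Binary.Definitions using (Tri; tri<; tri≈; tri>)
open import Relation.Binary.PropositionalEquality
  using (_≡_; _≢_; refl; sym; trans; cong; cong₂; subst; subst₂; module ≡-Reasoning)
open import Relation.Nullary.Decidable using (Dec; does; yes; no; dec-true)
open import Relation.Nullary.Negation using (¬_; contradiction)

-- Timed execution of stack programs

-- A gap vertex has one interval per track, so three copies of the line let it cover the line up to
-- two gaps, and a point repeated on all tracks meets it iff it lies outside the gaps. All gap
-- vertices contain 0 on the first track; hence they are pairwise nonadjacent in the complement, and
-- only a point or the vertex itself can dominate one. The order vertices with o = n and o = 0 have
-- points of a single half-block in their gaps, which gives 2 k separate demands; as the budget is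
-- exactly 2 k, a dominating set contains nothing else, in particular no pair vertex. Half-blocks
-- have length n + 1, so a gap of that length starting at (i , 0 , u) ends at (i , 1 , u) and tests
-- a > u and a′ < u at once. Indices with i ≥ j or with u and v adjacent impose no condition; they
-- are kept as vertices missing all points, so that the vertex set is a sum of products and can be
-- printed by plain nested loops. The reduction also has to be a program with a proved running time;
-- it is therefore written in a small loop language, whose compiler to stack programs is verified
-- once for all programs.

Exec : ∀ {m} → Program m → State m → State m → ℕ → Set
Exec p σ σ′ b = ∃[ t ] t ≤ b × Run p σ σ′ t

weaken : ∀ {m} {p : Program m} {σ σ′ b b′} → b ≤ b′ → Exec p σ σ′ b → Exec p σ σ′ b′
weaken b≤b′ (t , t≤b , r) = t , ≤-trans t≤b b≤b′ , r

exec-skip : ∀ {m} {σ : State m} → Exec skip σ σ 1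
exec-skip = 1 , ≤-refl , run-skip

exec-push : ∀ {m} {σ σ′ : State m} {r s w} →
  lookup σ r ≡ w → σ [ r ]≔ (s ∷ w) ≡ σ′ → Exec (push r s) σ σ′ 1
exec-push refl refl = 1 , ≤-refl , run-push

exec-⨾ : ∀ {m} {p q : Program m} {σ σ₁ σ₂ a b} →
  Exec p σ σ₁ a → Exec q σ₁ σ₂ b → Exec (p ⨾ q) σ σ₂ (a + b)
exec-⨾ (t , t≤a , r) (u , u≤b , r′) = t + u , +-mono-≤ t≤a u≤b , run-⨾ r r′

exec-pop : ∀ {m} {p : Program m} {q σ σ₁ σ₂ r s w b} →
  lookup σ r ≡ s ∷ w → σ [ r ]≔ w ≡ σ₁ → Exec (q s) σ₁ σ₂ b → Exec (pop r p q) σ σ₂ (suc b)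
exec-pop eq refl (t , t≤b , run) = suc t , s≤s t≤b , run-pop-nonempty eq run

exec-pop-empty : ∀ {m} {p : Program m} {q σ σ′ r b} →
  lookup σ r ≡ [] → Exec p σ σ′ b → Exec (pop r p q) σ σ′ (suc b)
exec-pop-empty eq (t , t≤b , run) = suc t , s≤s t≤b , run-pop-empty eq run

exec-while-empty : ∀ {m} {p : Program m} {σ r b} →
  lookup σ r ≡ [] → Exec (while r p) σ σ (suc b)
exec-while-empty eq = 1 , s≤s z≤n , run-while-empty eq

exec-while-step : ∀ {m} {p : Program m} {σ σ₁ σ₂ r s w a b} →
  lookup σ r ≡ s ∷ w → Exec p σ σ₁ a → Exec (while r p) σ₁ σ₂ b →
  Exec (while r p) σ σ₂ (suc (a + b))
exec-while-step eq (t , t≤a , run) (u , u≤b , run′) =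
  suc (t + u) , s≤s (+-mono-≤ t≤a u≤b) , run-while-nonempty eq run run′

tally : ℕ → Word
tally x = replicate x (bit true)

-- The effect of a `while` on a unary counter: the loop index runs from x ∸ 1 down to 0, and each
-- value updates the accumulator.
countdown : ∀ {A : Set} → (ℕ → A → A) → ℕ → A → A
countdown step zero    a = a
countdown step (suc x) a = countdown step x (step x a)

-- The invariant `σ x a` describes the stacks when x iterations remain and a has been accumulated.
-- An iteration costs its body and one test, the final test costs 1.
exec-while : ∀ {m A} {p : Program m} {r b} (σ : ℕ → A → State m) (step : ℕ → A → A) v →
  (∀ x a → lookup (σ x a) r ≡ tally x) →
  (∀ x a → x < v → Exec p (σ (suc x) a) (σ x (step x a)) b) →
  ∀ a → Exec (while r p) (σ v a) (σ 0 (countdown step v a)) (suc (v * suc b))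
exec-while σ step zero    counter body a = exec-while-empty (counter 0 a)
exec-while {p = p} {r} {b} σ step (suc v) counter body a =
  weaken (s≤s (≤-reflexive (+-suc b (v * suc b))))
    (exec-while-step (counter (suc v) a) (body v a ≤-refl)
      (exec-while σ step v counter (λ x a x<v → body x a (m≤n⇒m≤1+n x<v)) (step v a)))

-- `z ⊕ m` is z + m, defined so that turning one of z spare registers into the
-- newest of the registers in use, i.e. suc z ⊕ m = z ⊕ suc m, is definitional.
infixr 5 _⊕_
_⊕_ : ℕ → ℕ → ℕ
zero  ⊕ m = m
suc z ⊕ m = z ⊕ suc m

place : ∀ z {m} → Vec Word m → Vec Word (z ⊕ m)
place zero    ws = ws
place (suc z) ws = place z ([] Vec.∷ ws)

slot : ∀ z {m} → Fin m → Fin (z ⊕ m)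
slot zero    i = i
slot (suc z) i = slot z (suc i)

lookup-place : ∀ z {m} (ws : Vec Word m) i → lookup (place z ws) (slot z i) ≡ lookup ws i
lookup-place zero    ws i = refl
lookup-place (suc z) ws i = lookup-place z ([] Vec.∷ ws) (suc i)

update-place : ∀ z {m} (ws : Vec Word m) i w →
  place z ws [ slot z i ]≔ w ≡ place z (ws [ i ]≔ w)
update-place zero    ws i w = refl
update-place (suc z) ws i w = update-place z ([] Vec.∷ ws) (suc i) w

Machine : ℕ → ℕ → Set
Machine z m = Program (3 + (z ⊕ m))

-- Stack zero receives the output, the next one holds the adjacency matrix of
-- the input, the third one is auxiliary, the others are registers.
out mat aux : ∀ {n} → Fin (3 + n)
out = zero
mat = suc zero
aux = suc (suc zero)

reg : ∀ z {m} → Fin m → Fin (3 + (z ⊕ m))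
reg z i = suc (suc (suc (slot z i)))

-- Registers hold numbers in unary.
record Config (m : ℕ) : Set where
  constructor config
  field
    output matrix scratch : Word
    registers             : Vec ℕ m

stacks : ∀ z {m} → Config m → State (3 + (z ⊕ m))
stacks z (config o M a ρ) = o Vec.∷ M Vec.∷ a Vec.∷ place z (Vec.map tally ρ)

-- A record, since configurations cannot be recovered by unification from their images under
-- `stacks`.
record Step (z : ℕ) {m : ℕ} (p : Machine z m) (c c′ : Config m) (b : ℕ) : Set where
  constructor step
  field
    exec : Exec p (stacks z c) (stacks z c′) b

open Step

relax : ∀ {z m p b b′} {c c′ : Config m} → b ≤ b′ → Step z p c c′ b → Step z p c c′ b′
relax b≤b′ (step e) = step (weaken b≤b′ e)

step-skip : ∀ {z m} {c : Config m} → Step z skip c c 1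
step-skip = step exec-skip

infixr 5 _▹_
_▹_ : ∀ {z m p q a b} {c c₁ c₂ : Config m} →
  Step z p c c₁ a → Step z q c₁ c₂ b → Step z (p ⨾ q) c c₂ (a + b)
step e ▹ step e′ = step (exec-⨾ e e′)

step-while : ∀ {z m A p r b} (c : ℕ → A → Config m) (f : ℕ → A → A) v →
  (∀ x a → lookup (stacks z (c x a)) r ≡ tally x) →
  (∀ x a → x < v → Step z p (c (suc x) a) (c x (f x a)) b) →
  ∀ a → Step z (while r p) (c v a) (c 0 (countdown f v a)) (suc (v * suc b))
step-while {z} c f v counter body a =
  step (exec-while (λ x a → stacks z (c x a)) f v counter (λ x a x<v → exec (body x a x<v)) a)

lookup-reg : ∀ z {m} (ρ : Vec ℕ m) i →
  lookup (place z (Vec.map tally ρ)) (slot z i) ≡ tally (lookup ρ i)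
lookup-reg z ρ i = trans (lookup-place z _ i) (lookup-map i tally ρ)

update-reg : ∀ z {m o M a} (ρ : Vec ℕ m) i x →
  stacks z (config o M a ρ) [ reg z i ]≔ tally x ≡ stacks z (config o M a (ρ [ i ]≔ x))
update-reg z {o = o} {M} {a} ρ i x = cong (λ ws → o Vec.∷ M Vec.∷ a Vec.∷ ws)
  (trans (update-place z _ i (tally x)) (cong (place z) (sym (map-[]≔ tally ρ i))))

inc : ∀ z {m} → Fin m → Machine z m
inc z i = push (reg z i) (bit true)

-- Harmless on a register holding 0, which is what makes repeated decrements a truncated
-- subtraction.
dec : ∀ z {m} → Fin m → Machine z m
dec z i = pop (reg z i) skip (λ _ → skip)

step-inc : ∀ {z m o M a} {ρ : Vec ℕ m} i →
  Step z (inc z i) (config o M a ρ) (config o M a (ρ [ i ]≔ suc (lookup ρ i))) 1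
step-inc {z} {ρ = ρ} i =
  step (exec-push (lookup-reg z ρ i) (update-reg z ρ i (suc (lookup ρ i))))

step-pop : ∀ {z m o M a} {ρ : Vec ℕ m} {p q c b x} i → lookup ρ i ≡ suc x →
  Step z (q (bit true)) (config o M a (ρ [ i ]≔ x)) c b →
  Step z (pop (reg z i) p q) (config o M a ρ) c (suc b)
step-pop {z} {ρ = ρ} {x = x} i eq (step e) =
  step (exec-pop (trans (lookup-reg z ρ i) (cong tally eq)) (update-reg z ρ i x) e)

step-pop-empty : ∀ {z m o M a} {ρ : Vec ℕ m} {p q c b} i → lookup ρ i ≡ 0 →
  Step z p (config o M a ρ) c b →
  Step z (pop (reg z i) p q) (config o M a ρ) c (suc b)
step-pop-empty {z} {ρ = ρ} i eq (step e) =
  step (exec-pop-empty (trans (lookup-reg z ρ i) (cong tally eq)) e)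

step-dec : ∀ {z m o M a} {ρ : Vec ℕ m} i x → lookup ρ i ≡ suc x →
  Step z (dec z i) (config o M a ρ) (config o M a (ρ [ i ]≔ x)) 2
step-dec i x eq = step-pop i eq step-skip

-- A language of bounded loops

infixl 6 _⊹_ _⊖_
infixl 7 _⊛_

data Op : Set where
  add mul monus : Op

apply : Op → ℕ → ℕ → ℕ
apply add   = _+_
apply mul   = _*_
apply monus = _∸_

data Exp (m : ℕ) : Set where
  var : Fin m → Exp m
  lit : ℕ → Exp m
  bin : Op → Exp m → Exp m → Exp m
  -- the bit of the input matrix, read as a single string, at a given position
  at  : Exp m → Exp m

pattern _⊹_ e e′ = bin add e e′
pattern _⊛_ e e′ = bin mul e e′
pattern _⊖_ e e′ = bin monus e e′

value : Bool → ℕ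
value true  = 1
value false = 0

bitAt : Word → ℕ → ℕ
bitAt []          x       = 0
bitAt (s ∷ w)     (suc x) = bitAt w x
bitAt (bit b ∷ w) zero    = value b
bitAt (sep ∷ w)   zero    = 0

⟦_⟧ : ∀ {m} → Exp m → Word → (Fin m → ℕ) → ℕ
⟦ var i ⟧      M γ = γ i
⟦ lit x ⟧      M γ = x
⟦ bin o e e′ ⟧ M γ = apply o (⟦ e ⟧ M γ) (⟦ e′ ⟧ M γ)
⟦ at e ⟧       M γ = bitAt M (⟦ e ⟧ M γ)

infixr 4 _∙_

data Prog (m : ℕ) : Set where
  emit  : Symbol → Prog m
  _∙_   : Prog m → Prog m → Prog m
  loop  : Exp m → Prog (suc m) → Prog m
  ifPos : Exp m → Prog m → Prog m → Prog m

choose : ∀ {A : Set} → ℕ → A → A → A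
choose zero    a b = b
choose (suc _) a b = a

run : ∀ {m} → Prog m → Word → Vec ℕ m → Word
run (emit s)      M ρ = s ∷ []
run (P ∙ Q)       M ρ = run P M ρ ++ run Q M ρ
run (loop e P)    M ρ = concat (tabulate {n = ⟦ e ⟧ M (lookup ρ)} λ x → run P M (toℕ x Vec.∷ ρ))
run (ifPos e P Q) M ρ = choose (⟦ e ⟧ M (lookup ρ)) (run P M ρ) (run Q M ρ)

-- Compilation of the loop language to stack programs

pattern #0 = zero
pattern #1 = suc zero
pattern #2 = suc (suc zero)

-- Adds register i to register zero, from which i must differ.
copy : ∀ z {m} → Fin (suc m) → Machine z (suc m)
copy z i =
  while (reg z i) (dec z i ⨾ push aux (bit true)) ⨾
  while aux (pop aux skip (λ _ → skip) ⨾ inc z i ⨾ inc z #0)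

-- The operands are in registers 2 and 1, register 0 is a spare one; the result
-- replaces the first operand.
operate : Op → ∀ z {m} → Machine z (3 + m)
operate add   z = while (reg z #1) (dec z #1 ⨾ inc z #2)
operate monus z = while (reg z #1) (dec z #1 ⨾ dec z #2)
operate mul   z =
  while (reg z #1) (dec z #1 ⨾ copy z #2) ⨾
  while (reg z #2) (dec z #2) ⨾
  while (reg z #0) (dec z #0 ⨾ inc z #2)

pushAll : ∀ {m} → Fin m → Word → Program m
pushAll r []      = skip
pushAll r (s ∷ w) = push r s ⨾ pushAll r w

-- The `skip` makes both clauses equally long, so that one cost covers all symbols.
putBack : ∀ z {m} → Symbol → Machine z (suc m)
putBack z (bit true) = push mat (bit true) ⨾ inc z #0
putBack z s          = push mat s ⨾ skip

readBit : ∀ z {m} → Machine z (suc m)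
readBit z =
  while (reg z #0) (dec z #0 ⨾ pop mat skip (push aux)) ⨾
  pop mat skip (putBack z) ⨾
  while aux (pop aux skip (push mat))

compileExp : ∀ z {m m′} → (Fin m → Fin m′) → Exp m → Machine z (suc m′)
compileExp z f (var i) = copy z (suc (f i))
compileExp z f (lit x) = pushAll (reg z #0) (tally x)
compileExp (suc (suc z)) f (bin o e e′) =
  compileExp (suc (suc z)) f e ⨾ compileExp (suc z) (suc ∘ f) e′ ⨾ operate o z
compileExp _ f (bin o e e′) = skip
compileExp z f (at e) = compileExp z f e ⨾ readBit z

-- The output is a stack, so that it is produced from its end to its start.
compile : ∀ z {m} → Prog m → Machine z m
compile z (emit s) = push out s
compile z (P ∙ Q)  = compile z Q ⨾ compile z P
compile (suc z) (loop e P) =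
  compileExp z id e ⨾ while (reg z #0) (dec z #0 ⨾ compile z P)
compile (suc z) (ifPos e P Q) = compileExp z id e ⨾
  pop (reg z #0) (compile (suc z) Q)
    (λ _ → while (reg z #0) (dec z #0) ⨾ compile (suc z) P)
compile zero _ = skip

-- A number of spare registers that suffices for the compiled expression.
depthExp : ∀ {m} → Exp m → ℕ
depthExp (var i)      = 0
depthExp (lit x)      = 0
depthExp (bin o e e′) = 2 + (depthExp e ⊔ depthExp e′)
depthExp (at e)       = depthExp e

depth : ∀ {m} → Prog m → ℕ
depth (emit s)      = 0
depth (P ∙ Q)       = depth P ⊔ depth Q
depth (loop e P)    = suc (depthExp e ⊔ depth P)
depth (ifPos e P Q) = suc (depthExp e ⊔ depth P ⊔ depth Q)

-- Correctness and cost of the basic operations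

retarget : ∀ {z m p b} {c c′ c″ : Config m} → c′ ≡ c″ → Step z p c c′ b → Step z p c c″ b
retarget refl s = s

step-push : ∀ {z m o M a s} {ρ : Vec ℕ m} →
  Step z (push out s) (config o M a ρ) (config (s ∷ o) M a ρ) 1
step-push = step (exec-push refl refl)

step-push-mat : ∀ {z m o M a s} {ρ : Vec ℕ m} →
  Step z (push mat s) (config o M a ρ) (config o (s ∷ M) a ρ) 1
step-push-mat = step (exec-push refl refl)

step-push-aux : ∀ {z m o M a s} {ρ : Vec ℕ m} →
  Step z (push aux s) (config o M a ρ) (config o M (s ∷ a) ρ) 1
step-push-aux = step (exec-push refl refl)

step-pop-mat : ∀ {z m o M a s p q b c} {ρ : Vec ℕ m} → Step z (q s) (config o M a ρ) c b →
  Step z (pop mat p q) (config o (s ∷ M) a ρ) c (suc b)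
step-pop-mat (step e) = step (exec-pop refl refl e)

step-pop-aux : ∀ {z m o M a s p q b c} {ρ : Vec ℕ m} → Step z (q s) (config o M a ρ) c b →
  Step z (pop aux p q) (config o M (s ∷ a) ρ) c (suc b)
step-pop-aux (step e) = step (exec-pop refl refl e)

countdown-suc : ∀ x a → countdown (λ _ → suc) x a ≡ x + a
countdown-suc zero    a = refl
countdown-suc (suc x) a = trans (countdown-suc x (suc a)) (+-suc x a)

countdown-+ : ∀ y x a → countdown (λ _ → y +_) x a ≡ x * y + a
countdown-+ y zero    a = refl
countdown-+ y (suc x) a = begin
  countdown (λ _ → y +_) x (y + a) ≡⟨ countdown-+ y x (y + a) ⟩
  x * y + (y + a)                  ≡⟨ +-assoc (x * y) y a ⟨
  x * y + y + a                    ≡⟨ cong (_+ a) (+-comm (x * y) y) ⟩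
  y + x * y + a                    ∎
  where open ≡-Reasoning

countdown-pred : ∀ x a → countdown (λ _ → pred) x a ≡ a ∸ x
countdown-pred zero    a = refl
countdown-pred (suc x) zero    = trans (countdown-pred x 0) (0∸n≡0 x)
countdown-pred (suc x) (suc a) = countdown-pred x a

copyCost : ℕ → ℕ
copyCost x = suc (x * 4) + suc (x * 5)

-- Reading a register destroys it, so its content travels to `aux` and from there back into both
-- registers. The two loops have the invariants `c₁` and `c₂`.
step-copy : ∀ {z m o M y} {ρ : Vec ℕ m} i → Step z (copy z (suc i))
  (config o M [] (y Vec.∷ ρ)) (config o M [] (lookup ρ i + y Vec.∷ ρ)) (copyCost (lookup ρ i))
step-copy {z} {o = o} {M} {y} {ρ} i = retarget end (retarget mid out-phase ▹ back-phase)
  where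
  x = lookup ρ i
  c₁ : ℕ → ℕ → Config _
  c₁ w a = config o M (tally a) (y Vec.∷ ρ [ i ]≔ w)
  c₂ : ℕ → ℕ → Config _
  c₂ w a = config o M (tally w) (a + y Vec.∷ ρ [ i ]≔ a)
  body₁ : ∀ w a → w < x → Step z (dec z (suc i) ⨾ push aux (bit true)) (c₁ (suc w) a) (c₁ w (suc a)) 3
  body₁ w a _ = retarget (cong (λ r → config o M (tally a) (y Vec.∷ r)) ([]≔-idempotent ρ i))
    (step-dec (suc i) w (lookup∘update i ρ (suc w))) ▹ step-push-aux
  body₂ : ∀ w a → w < x →
    Step z (pop aux skip (λ _ → skip) ⨾ inc z (suc i) ⨾ inc z #0) (c₂ (suc w) a) (c₂ w (suc a)) 4
  body₂ w a _ = step-pop-aux step-skip ▹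
    retarget (cong (λ r → config o M (tally w) (a + y Vec.∷ r))
        (trans ([]≔-idempotent ρ i) (cong (λ b → ρ [ i ]≔ suc b) (lookup∘update i ρ a))))
      (step-inc (suc i)) ▹
    step-inc zero
  out-phase : Step z (while (reg z (suc i)) (dec z (suc i) ⨾ push aux (bit true)))
    (config o M [] (y Vec.∷ ρ)) (c₁ 0 (countdown (λ _ → suc) x 0)) (suc (x * 4))
  out-phase = subst (λ r → Step z (while (reg z (suc i)) (dec z (suc i) ⨾ push aux (bit true)))
      (config o M [] (y Vec.∷ r)) (c₁ 0 (countdown (λ _ → suc) x 0)) (suc (x * 4))) ([]≔-lookup ρ i)
    (step-while {b = 3} c₁ (λ _ → suc) x
      (λ w a → trans (lookup-reg z (y Vec.∷ ρ [ i ]≔ w) (suc i)) (cong tally (lookup∘update i ρ w)))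
      body₁ 0)
  mid : c₁ 0 (countdown (λ _ → suc) x 0) ≡ c₂ x 0
  mid = cong (λ a → config o M (tally a) (y Vec.∷ ρ [ i ]≔ 0))
    (trans (countdown-suc x 0) (+-identityʳ x))
  back-phase : Step z (while aux (pop aux skip (λ _ → skip) ⨾ inc z (suc i) ⨾ inc z #0))
    (c₂ x 0) (c₂ 0 (countdown (λ _ → suc) x 0)) (suc (x * 5))
  back-phase = step-while c₂ (λ _ → suc) x (λ w a → refl) body₂ 0
  end : c₂ 0 (countdown (λ _ → suc) x 0) ≡ config o M [] (x + y Vec.∷ ρ)
  end = trans (cong (c₂ 0) (trans (countdown-suc x 0) (+-identityʳ x)))
    (cong (λ r → config o M [] (x + y Vec.∷ r)) ([]≔-lookup ρ i))

step-clear : ∀ {z m o M a} {ρ : Vec ℕ m} x → Step z (while (reg z #0) (dec z #0))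
  (config o M a (x Vec.∷ ρ)) (config o M a (0 Vec.∷ ρ)) (suc (x * 3))
step-clear {z} {o = o} {M} {a} {ρ} x = step-while (λ w (_ : ⊤) → config o M a (w Vec.∷ ρ)) (λ _ → id) x
  (λ w _ → lookup-reg z (w Vec.∷ ρ) zero) (λ w _ _ → step-dec zero w refl) tt

operateCost : Op → ℕ → ℕ → ℕ
operateCost add   x y = suc (y * 4)
operateCost monus x y = suc (y * 5)
operateCost mul   x y =
  suc (y * suc (2 + copyCost x)) + (suc (x * 3) + suc (y * x * 4))

step-operate : ∀ op {z m o M x y} {ρ : Vec ℕ m} → Step z (operate op z)
  (config o M [] (0 Vec.∷ y Vec.∷ x Vec.∷ ρ)) (config o M [] (0 Vec.∷ 0 Vec.∷ apply op x y Vec.∷ ρ))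
  (operateCost op x y)
step-operate add {z} {o = o} {M} {x} {y} {ρ} =
  retarget (cong (λ r → config o M [] (0 Vec.∷ 0 Vec.∷ r Vec.∷ ρ))
      (trans (countdown-suc y x) (+-comm y x)))
    (step-while (λ w a → config o M [] (0 Vec.∷ w Vec.∷ a Vec.∷ ρ)) (λ _ → suc) y
      (λ w a → lookup-reg z (0 Vec.∷ w Vec.∷ a Vec.∷ ρ) #1)
      (λ w a _ → step-dec #1 w refl ▹ step-inc #2) x)
step-operate monus {z} {o = o} {M} {x} {y} {ρ} =
  retarget (cong (λ r → config o M [] (0 Vec.∷ 0 Vec.∷ r Vec.∷ ρ)) (countdown-pred y x))
    (step-while (λ w a → config o M [] (0 Vec.∷ w Vec.∷ a Vec.∷ ρ)) (λ _ → pred) y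
      (λ w a → lookup-reg z (0 Vec.∷ w Vec.∷ a Vec.∷ ρ) #1)
      (λ w a _ → step-dec #1 w refl ▹ decrease w a) x)
  where
  decrease : ∀ w a → Step z (dec z #2)
    (config o M [] (0 Vec.∷ w Vec.∷ a Vec.∷ ρ)) (config o M [] (0 Vec.∷ w Vec.∷ pred a Vec.∷ ρ)) 2
  decrease w zero    = step-pop-empty #2 refl step-skip
  decrease w (suc a) = step-dec #2 a refl
step-operate mul {z} {o = o} {M} {x} {y} {ρ} =
  retarget (cong (λ a → config o M [] (a Vec.∷ 0 Vec.∷ x Vec.∷ ρ))
      (trans (countdown-+ x y 0) (+-identityʳ (y * x))))
    (step-while (λ w a → config o M [] (a Vec.∷ w Vec.∷ x Vec.∷ ρ)) (λ _ → x +_) y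
      (λ w a → lookup-reg z (a Vec.∷ w Vec.∷ x Vec.∷ ρ) #1)
      (λ w a _ → step-dec #1 w refl ▹ step-copy #1) 0) ▹
  step-while (λ w (_ : ⊤) → config o M [] (y * x Vec.∷ 0 Vec.∷ w Vec.∷ ρ)) (λ _ → id) x
    (λ w _ → lookup-reg z (y * x Vec.∷ 0 Vec.∷ w Vec.∷ ρ) #2) (λ w _ _ → step-dec #2 w refl) tt ▹
  retarget (cong (λ a → config o M [] (0 Vec.∷ 0 Vec.∷ a Vec.∷ ρ))
      (trans (countdown-suc (y * x) 0) (trans (+-identityʳ (y * x)) (*-comm y x))))
    (step-while (λ w a → config o M [] (w Vec.∷ 0 Vec.∷ a Vec.∷ ρ)) (λ _ → suc) (y * x)
      (λ w a → lookup-reg z (w Vec.∷ 0 Vec.∷ a Vec.∷ ρ) #0)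
      (λ w a _ → step-dec #0 w refl ▹ step-inc #2) 0)

step-pushAll : ∀ {z m o M a} {ρ : Vec ℕ m} x y →
  Step z (pushAll (reg z #0) (tally x)) (config o M a (y Vec.∷ ρ)) (config o M a (x + y Vec.∷ ρ)) (suc x)
step-pushAll zero    y = step-skip
step-pushAll {o = o} {M} {a} {ρ} (suc x) y =
  step-inc zero ▹ retarget (cong (λ w → config o M a (w Vec.∷ ρ)) (+-suc x y)) (step-pushAll x (suc y))

-- `aux` and `mat` act as the two halves of a tape; past the end of the matrix the head stays where
-- it is.
shift : Word × Word → Word × Word
shift (a , [])    = a , []
shift (a , s ∷ M) = s ∷ a , M

shifts : ℕ → Word × Word → Word × Word
shifts = countdown (λ _ → shift)

shifts-bitAt : ∀ x a M → bitAt (proj₂ (shifts x (a , M))) 0 ≡ bitAt M x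
shifts-bitAt zero    a M              = refl
shifts-bitAt (suc x) a []             = shifts-bitAt x a []
shifts-bitAt (suc x) a (s ∷ M)        = shifts-bitAt x (s ∷ a) M

-- The visited half, reversed onto the rest, is an invariant of the head movement; hence
-- `step-restore` recovers the whole matrix.
shifts-ʳ++ : ∀ x a M → proj₁ (shifts x (a , M)) ʳ++ proj₂ (shifts x (a , M)) ≡ a ʳ++ M
shifts-ʳ++ zero    a M       = refl
shifts-ʳ++ (suc x) a []      = shifts-ʳ++ x a []
shifts-ʳ++ (suc x) a (s ∷ M) = shifts-ʳ++ x (s ∷ a) M

shifts-length : ∀ x a M → length (proj₁ (shifts x (a , M))) ≤ x + length a
shifts-length zero    a M       = ≤-refl
shifts-length (suc x) a []      = m≤n⇒m≤1+n (shifts-length x a [])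
shifts-length (suc x) a (s ∷ M) =
  ≤-trans (shifts-length x (s ∷ a) M) (≤-reflexive (+-suc x (length a)))

step-restore : ∀ {z m o M ρ} a → Step z {m} (while aux (pop aux skip (push mat)))
  (config o M a ρ) (config o (a ʳ++ M) [] ρ) (suc (length a * 3))
step-restore []      = step (exec-while-empty refl)
step-restore {z} {o = o} {M} {ρ} (s ∷ a)
  with step-restore {z} {o = o} {s ∷ M} {ρ} a
     | step-pop-aux {z} {o = o} {M} {a} {s} {p = skip} {push mat} {ρ = ρ} step-push-mat
... | step rest | step body = step (exec-while-step refl body rest)

readBitCost : ℕ → ℕ
readBitCost x = suc (x * 5) + (3 + suc (x * 3))

step-readBit : ∀ {z m o M x} {ρ : Vec ℕ m} → Step z (readBit z)
  (config o M [] (x Vec.∷ ρ)) (config o M [] (bitAt M x Vec.∷ ρ)) (readBitCost x)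
step-readBit {z} {o = o} {M} {x} {ρ} =
  step-while {A = Word × Word} (λ w (a , N) → config o N a (w Vec.∷ ρ)) (λ _ → shift) x
    (λ w (a , N) → lookup-reg z (w Vec.∷ ρ) #0) (λ w (a , N) _ → step-dec #0 w refl ▹ advance a N) ([] , M) ▹
  peek N ▹
  relax (s≤s (*-monoˡ-≤ 3 (≤-trans (shifts-length x [] M) (≤-reflexive (+-identityʳ x)))))
    (retarget (cong₂ (λ N b → config o N [] (b Vec.∷ ρ)) (shifts-ʳ++ x [] M) (shifts-bitAt x [] M))
      (step-restore a))
  where
  a = proj₁ (shifts x ([] , M))
  N = proj₂ (shifts x ([] , M))
  advance : ∀ {w} a N → Step z (pop mat skip (push aux)) (config o N a (w Vec.∷ ρ))
    (config o (proj₂ (shift (a , N))) (proj₁ (shift (a , N))) (w Vec.∷ ρ)) 2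
  advance a []      = step (exec-pop-empty refl exec-skip)
  advance a (s ∷ N) = step-pop-mat step-push-aux
  peek : ∀ {a} N → Step z (pop mat skip (putBack z))
    (config o N a (0 Vec.∷ ρ)) (config o N a (bitAt N 0 Vec.∷ ρ)) 3
  peek []              = relax (s≤s (s≤s z≤n)) (step (exec-pop-empty refl exec-skip))
  peek (bit true ∷ N)  = step-pop-mat (step-push-mat ▹ step-inc #0)
  peek (bit false ∷ N) = step-pop-mat (step-push-mat ▹ step-skip)
  peek (sep ∷ N)       = step-pop-mat (step-push-mat ▹ step-skip)

-- A record rather than the bare inequality, so that d can be inferred from the
-- way in which the bound is assembled.
record Power (s d a : ℕ) : Set where
  constructor power
  field
    2≤s   : 2 ≤ s
    bound : a ≤ s ^ d

open Power

infixl 6 _⊞_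
infixl 7 _⊠_

_⊠_ : ∀ {s i j a b} → Power s i a → Power s j b → Power s (i + j) (a * b)
_⊠_ {s} {i} {j} (power 2≤s a≤) (power _ b≤) =
  power 2≤s (≤-trans (*-mono-≤ a≤ b≤) (≤-reflexive (sym (^-distribˡ-+-* s i j))))

Power-mono : ∀ {s i j a b} → i ≤ j → b ≤ a → Power s i a → Power s j b
Power-mono {s@(suc _)} i≤j b≤a (power 2≤s a≤) = power 2≤s (≤-trans b≤a (≤-trans a≤ (^-monoʳ-≤ s i≤j)))

-- Both summands are at most s ^ (i + j), and 2 ≤ s absorbs the factor 2 into one more power.
_⊞_ : ∀ {s i j a b} → Power s i a → Power s j b → Power s (suc (i + j)) (a + b)
_⊞_ {s} {i} {j} {a} {b} p q = power (2≤s p) (begin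
  a + b                     ≤⟨ +-mono-≤ (bound (Power-mono (m≤m+n i j) ≤-refl p))
                                        (bound (Power-mono (m≤n+m j i) ≤-refl q)) ⟩
  s ^ (i + j) + s ^ (i + j) ≡⟨ cong (s ^ (i + j) +_) (+-identityʳ _) ⟨
  2 * s ^ (i + j)           ≤⟨ *-monoˡ-≤ (s ^ (i + j)) (2≤s p) ⟩
  s ^ suc (i + j)           ∎)
  where open ≤-Reasoning

constant : ∀ {s} → 2 ≤ s → ∀ c → Power s c c
constant 2≤s zero    = power 2≤s z≤n
constant 2≤s (suc c) = power {d = 0} 2≤s ≤-refl ⊞ constant 2≤s c

base : ∀ {s a} → 2 ≤ s → a ≤ s → Power s 1 a
base {s} 2≤s a≤s = power 2≤s (≤-trans a≤s (≤-reflexive (sym (*-identityʳ s))))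

-- The exponent function is left to unification, which reads it off the composition of the cost.
Power-operate : ∀ op → Σ[ f ∈ (ℕ → ℕ → ℕ) ]
  ∀ {s i j x y} → Power s i x → Power s j y → Power s (f i j) (operateCost op x y)
Power-operate add   = _ , λ p q → constant (2≤s p) 1 ⊞ q ⊠ constant (2≤s p) 4
Power-operate monus = _ , λ p q → constant (2≤s p) 1 ⊞ q ⊠ constant (2≤s p) 5
Power-operate mul   = _ , λ p q → let c = constant (2≤s p) in
  c 1 ⊞ q ⊠ (c 3 ⊞ (c 1 ⊞ p ⊠ c 4 ⊞ (c 1 ⊞ p ⊠ c 5))) ⊞ (c 1 ⊞ p ⊠ c 3 ⊞ (c 1 ⊞ q ⊠ p ⊠ c 4))

Power-apply : ∀ op {s i j x y} → Power s i x → Power s j y → Power s (suc (i + j)) (apply op x y)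
Power-apply add   p q = p ⊞ q
Power-apply mul   p q = Power-mono (n≤1+n _) ≤-refl (p ⊠ q)
Power-apply monus {i = i} {j} {x} {y} p q = Power-mono (m≤n⇒m≤1+n (m≤m+n i j)) (m∸n≤m x y) p

-- Polynomial running time of compiled programs

record Within (s d z : ℕ) {m : ℕ} (p : Machine z m) (c c′ : Config m) : Set where
  constructor within
  field
    {cost}     : ℕ
    cost-power : Power s d cost
    steps      : Step z p c c′ cost

infixr 5 _▸_
_▸_ : ∀ {s i j z m p q} {c c₁ c₂ : Config m} →
  Within s i z p c c₁ → Within s j z q c₁ c₂ → Within s (suc (i + j)) z (p ⨾ q) c c₂
within b e ▸ within b′ e′ = within (b ⊞ b′) (e ▹ e′)

-- A spare register is one holding 0, so by the definition of `place` the stacks on both sides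
-- coincide.
allocate : ∀ {s d z m p o o′ M M′ a a′} {ρ ρ′ : Vec ℕ m} →
  Within s d z p (config o M a (0 Vec.∷ ρ)) (config o′ M′ a′ (0 Vec.∷ ρ′)) →
  Within s d (suc z) p (config o M a ρ) (config o′ M′ a′ ρ′)
allocate (within b (step e)) = within b (step e)

free : ∀ {s d z m p o o′ M M′ a a′} {ρ ρ′ : Vec ℕ m} →
  Within s d (suc z) p (config o M a ρ) (config o′ M′ a′ ρ′) →
  Within s d z p (config o M a (0 Vec.∷ ρ)) (config o′ M′ a′ (0 Vec.∷ ρ′))
free (within b (step e)) = within b (step e)

bitAt≤1 : ∀ M x → bitAt M x ≤ 1
bitAt≤1 []              x       = z≤n
bitAt≤1 (s ∷ M)         (suc x) = bitAt≤1 M x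
bitAt≤1 (bit true ∷ M)  zero    = ≤-refl
bitAt≤1 (bit false ∷ M) zero    = z≤n
bitAt≤1 (sep ∷ M)       zero    = z≤n

-- Exponents for values rather than costs; a matrix bit is at most 1 = s ^ 0.
degree : ∀ {m} → Exp m → ℕ
degree (var i)      = 1
degree (lit x)      = x
degree (bin o e e′) = suc (degree e + degree e′)
degree (at e)       = 0

Power-value : ∀ {m s M γ} (e : Exp m) → 2 ≤ s → (∀ i → γ i ≤ s) → Power s (degree e) (⟦ e ⟧ M γ)
Power-value (var i)      2≤s γ≤s = base 2≤s (γ≤s i)
Power-value (lit x)      2≤s γ≤s = constant 2≤s x
Power-value (bin o e e′) 2≤s γ≤s = Power-apply o (Power-value e 2≤s γ≤s) (Power-value e′ 2≤s γ≤s)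
Power-value {M = M} (at e) 2≤s γ≤s = power 2≤s (bitAt≤1 M _)

-- The exponent d precedes the quantifiers over s, the registers and the matrix; this uniformity is
-- what makes the final exponent depend on the program alone.
CompiledExp : ∀ {m} → Exp m → ℕ → Set
CompiledExp {m} e d = ∀ z {m′} (f : Fin m → Fin m′) {s o M ρ} →
  2 ≤ s → (∀ i → lookup ρ (f i) ≤ s) → depthExp e ≤ z →
  Within s d z (compileExp z f e) (config o M [] (0 Vec.∷ ρ))
    (config o M [] (⟦ e ⟧ M (lookup ρ ∘ f) Vec.∷ ρ))

compileExp-correct : ∀ {m} (e : Exp m) → ∃[ d ] CompiledExp e d
compileExp-correct (var i) = _ , λ z f {s} {o} {M} {ρ} 2≤s γ≤s _ →
  let c = constant 2≤s ; v = base 2≤s (γ≤s i) in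
  within (c 1 ⊞ v ⊠ c 4 ⊞ (c 1 ⊞ v ⊠ c 5))
    (retarget (cong (λ x → config o M [] (x Vec.∷ ρ)) (+-identityʳ _)) (step-copy (f i)))
compileExp-correct (lit x) = _ , λ z f {s} {o} {M} {ρ} 2≤s _ _ →
  within (constant 2≤s (suc x))
    (retarget (cong (λ y → config o M [] (y Vec.∷ ρ)) (+-identityʳ x)) (step-pushAll x 0))
compileExp-correct {m} (bin op e e′) = _ , correct
  where
  correct : CompiledExp (bin op e e′) _
  correct (suc (suc z)) f {s} {o} {M} {ρ} 2≤s γ≤s (s≤s (s≤s depth≤z)) = allocate (allocate (
    free (free (proj₂ (compileExp-correct e) (suc (suc z)) f {o = o} {M} {ρ} 2≤s γ≤s
      (m≤n⇒m≤1+n (m≤n⇒m≤1+n (m⊔n≤o⇒m≤o (depthExp e) _ depth≤z))))) ▸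
    free (proj₂ (compileExp-correct e′) (suc z) (suc ∘ f) {o = o} {M} {v Vec.∷ ρ} 2≤s γ≤s
      (m≤n⇒m≤1+n (m⊔n≤o⇒n≤o (depthExp e) _ depth≤z))) ▸
    within (proj₂ (Power-operate op) (Power-value {M = M} e 2≤s γ≤s) (Power-value {M = M} e′ 2≤s γ≤s))
      (step-operate op)))
    where
    v = ⟦ e ⟧ M (lookup ρ ∘ f)
compileExp-correct (at e) = _ , λ z f 2≤s γ≤s depth≤z →
  let c = constant 2≤s ; v = Power-value e 2≤s γ≤s in
  proj₂ (compileExp-correct e) z f 2≤s γ≤s depth≤z ▸
  within (c 1 ⊞ v ⊠ c 5 ⊞ (c 3 ⊞ (c 1 ⊞ v ⊠ c 3))) step-readBit

-- The index decreases while words are prepended, so they end up in increasing order.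
countdown-concat : ∀ (w : ℕ → Word) v o →
  countdown (λ x o → w x ++ o) v o ≡ concat (tabulate {n = v} (w ∘ toℕ)) ++ o
countdown-concat w zero    o = refl
countdown-concat w (suc v) o = begin
  countdown (λ x o → w x ++ o) (suc v) o                   ≡⟨ first w v o ⟩
  w 0 ++ countdown (λ x o → w (suc x) ++ o) v o            ≡⟨ cong (w 0 ++_) (countdown-concat (w ∘ suc) v o) ⟩
  w 0 ++ concat (tabulate {n = v} (w ∘ suc ∘ toℕ)) ++ o    ≡⟨ ++-assoc (w 0) _ o ⟨
  (w 0 ++ concat (tabulate {n = v} (w ∘ suc ∘ toℕ))) ++ o  ∎
  where
  open ≡-Reasoning
  first : ∀ (w : ℕ → Word) v o →
    countdown (λ x o → w x ++ o) (suc v) o ≡ w 0 ++ countdown (λ x o → w (suc x) ++ o) v o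
  first w zero    o = refl
  first w (suc v) o = first w v (w (suc v) ++ o)

Compiled : ∀ {m} → Prog m → ℕ → Set
Compiled P d = ∀ z {s o M ρ} → 2 ≤ s → (∀ i → lookup ρ i ≤ s) → depth P ≤ z →
  Within s d z (compile z P) (config o M [] ρ) (config (run P M ρ ++ o) M [] ρ)

-- The loop variable may exceed s, so the body is measured against s′ = s ^ suc (degree e), which
-- dominates both s and the loop bound. Its cost s′ ^ d is again a power of s, with the exponents
-- multiplied.
compile-loop : ∀ {m} (e : Exp m) (P : Prog (suc m)) {d} → Compiled P d → ∃[ d′ ] Compiled (loop e P) d′
compile-loop {m} e P {d} P-correct = _ , correct
  where
  correct : Compiled (loop e P) _
  correct (suc z) {s} {o} {M} {ρ} 2≤s ρ≤s (s≤s depth≤z) = allocate (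
    proj₂ (compileExp-correct e) z id {o = o} {M} {ρ} 2≤s ρ≤s (m⊔n≤o⇒m≤o (depthExp e) _ depth≤z) ▸
    within (constant 2≤s 1 ⊞ v-power ⊠ (constant 2≤s 3 ⊞ body-power))
      (retarget (cong (λ o → config o M [] (0 Vec.∷ ρ)) (countdown-concat (λ x → run P M (x Vec.∷ ρ)) v o))
        (step-while (λ x o → config o M [] (x Vec.∷ ρ)) (λ x o → run P M (x Vec.∷ ρ) ++ o) v
          (λ x _ → lookup-reg z (x Vec.∷ ρ) #0)
          (λ x o x<v → step-dec #0 x refl ▹ body x o x<v) o)))
    where
    v = ⟦ e ⟧ M (lookup ρ)
    v-power : Power s (degree e) v
    v-power = Power-value {M = M} e 2≤s ρ≤s
    s′ = s ^ suc (degree e)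
    s≤s′ : s ≤ s′
    s≤s′ = bound (Power-mono {i = 1} {suc (degree e)} {b = s} (s≤s z≤n) ≤-refl (base 2≤s ≤-refl))
    v≤s′ : v ≤ s′
    v≤s′ = bound (Power-mono (n≤1+n (degree e)) ≤-refl v-power)
    body-power : Power s (suc (degree e) * d) (s′ ^ d)
    body-power = power 2≤s (≤-reflexive (^-*-assoc s (suc (degree e)) d))
    body : ∀ x o → x < v → Step z (compile z P) (config o M [] (x Vec.∷ ρ))
      (config (run P M (x Vec.∷ ρ) ++ o) M [] (x Vec.∷ ρ)) (s′ ^ d)
    body x o x<v = relax (bound (Within.cost-power w)) (Within.steps w)
      where
      bounded : ∀ i → lookup (x Vec.∷ ρ) i ≤ s′
      bounded zero    = ≤-trans (<⇒≤ x<v) v≤s′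
      bounded (suc i) = ≤-trans (ρ≤s i) s≤s′
      w = P-correct z {o = o} {M} {x Vec.∷ ρ} (≤-trans 2≤s s≤s′) bounded (m⊔n≤o⇒n≤o (depthExp e) _ depth≤z)

raise : ∀ {s i j z m p} {c c′ : Config m} → i ≤ j → Within s i z p c c′ → Within s j z p c c′
raise i≤j (within b e) = within (Power-mono i≤j ≤-refl b) e

retarget-output : ∀ {s d z m p o o′ o″ M M′} {ρ ρ′ : Vec ℕ m} → o′ ≡ o″ →
  Within s d z p (config o M [] ρ) (config o′ M′ [] ρ′) →
  Within s d z p (config o M [] ρ) (config o″ M′ [] ρ′)
retarget-output refl w = w

compile-correct : ∀ {m} (P : Prog m) → ∃[ d ] Compiled P d
compile-correct (emit s) = _ , λ z 2≤s _ _ → within (constant 2≤s 1) step-push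
compile-correct (P ∙ Q) = _ , λ z {o = o} {M} {ρ} 2≤s ρ≤s depth≤z →
  retarget-output (sym (++-assoc (run P M ρ) (run Q M ρ) o))
    (proj₂ (compile-correct Q) z 2≤s ρ≤s (m⊔n≤o⇒n≤o (depth P) _ depth≤z) ▸
     proj₂ (compile-correct P) z 2≤s ρ≤s (m⊔n≤o⇒m≤o (depth P) _ depth≤z))
compile-correct (loop e P) = compile-loop e P (proj₂ (compile-correct P))
compile-correct (ifPos e P Q) = _ , correct
  where
  correct : Compiled (ifPos e P Q) _
  correct (suc z) {s} {o} {M} {ρ} 2≤s ρ≤s (s≤s depth≤z) = allocate (
    proj₂ (compileExp-correct e) z id {o = o} {M} {ρ} 2≤s ρ≤s (m⊔n≤o⇒m≤o (depthExp e) _ depthP≤z) ▸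
    branch (⟦ e ⟧ M (lookup ρ)) (Power-value {M = M} e 2≤s ρ≤s))
    where
    depthP≤z = m⊔n≤o⇒m≤o (depthExp e ⊔ depth P) _ depth≤z
    dP = proj₁ (compile-correct P)
    dQ = proj₁ (compile-correct Q)
    -- The tested register is 0 when a branch starts, so the branch may use it as a spare one.
    runP = free (proj₂ (compile-correct P) (suc z) {s} {o} {M} {ρ} 2≤s ρ≤s
      (m≤n⇒m≤1+n (m⊔n≤o⇒n≤o (depthExp e) _ depthP≤z)))
    runQ = free (proj₂ (compile-correct Q) (suc z) {s} {o} {M} {ρ} 2≤s ρ≤s
      (m≤n⇒m≤1+n (m⊔n≤o⇒n≤o (depthExp e ⊔ depth P) _ depth≤z)))
    -- A single exponent has to serve both branches; their sum does.
    thenDegree = suc (1 + suc (suc (1 + (degree e + 3)) + dP))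
    elseDegree = suc (1 + dQ)
    branch : ∀ v → Power s (degree e) v → Within s (thenDegree + elseDegree) z
      (pop (reg z #0) (compile (suc z) Q) (λ _ → while (reg z #0) (dec z #0) ⨾ compile (suc z) P))
      (config o M [] (v Vec.∷ ρ)) (config (choose v (run P M ρ) (run Q M ρ) ++ o) M [] (0 Vec.∷ ρ))
    branch zero    _ = raise (m≤n+m elseDegree thenDegree)
      (within (constant 2≤s 1 ⊞ Within.cost-power runQ) (step-pop-empty #0 refl (Within.steps runQ)))
    branch (suc v) p = raise (m≤m+n thenDegree elseDegree)
      (within (constant 2≤s 1 ⊞ (constant 2≤s 1 ⊞ Power-mono ≤-refl (n≤1+n v) p ⊠ constant 2≤s 3 ⊞ Within.cost-power runP))
        (step-pop #0 refl (step-clear v ▹ Within.steps runP)))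

-- Printing numbers and reading the input

concat-replicate : ∀ {A : Set} n (s : A) → concat (tabulate {n = n} λ _ → s ∷ []) ≡ replicate n s
concat-replicate zero    s = refl
concat-replicate (suc n) s = cong (s ∷_) (concat-replicate n s)

numeral : ∀ {m} → Exp m → Prog m
numeral e = loop e (emit (bit true)) ∙ emit sep

run-numeral : ∀ {m} (e : Exp m) M ρ → run (numeral e) M ρ ≡ unary (⟦ e ⟧ M (lookup ρ))
run-numeral e M ρ = cong (_++ sep ∷ []) (concat-replicate (⟦ e ⟧ M (lookup ρ)) (bit true))

consume : ∀ z {m} → Symbol → Machine z (suc m)
consume z (bit _) = inc z #0
consume z sep     = pop aux skip (λ _ → skip)

-- The auxiliary stack is nonempty as long as the separator has not been read.
readNumber : ∀ z {m} → Machine z (suc m)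
readNumber z = push aux sep ⨾ while aux (pop out skip (consume z))

step-consume : ∀ z {m o M y} {ρ : Vec ℕ m} x → Step z (while aux (pop out skip (consume z)))
  (config (unary x ++ o) M (sep ∷ []) (y Vec.∷ ρ)) (config o M [] (x + y Vec.∷ ρ)) (5 + x * 3)
step-consume z {o = o} {M} {y} {ρ} zero =
  step (exec-while-step {a = 3} refl
    (exec-pop refl refl (exec-pop refl refl exec-skip)) (exec-while-empty {b = 0} refl))
step-consume z {o = o} {M} {y} {ρ} (suc x) =
  step (weaken (≤-reflexive (solve 1 (λ a → con 3 :+ (con 5 :+ a) := con 5 :+ (con 3 :+ a)) refl (x * 3)))
    (exec-while-step {a = 2} refl (exec-pop refl refl (exec (step-inc {z} {ρ = y Vec.∷ ρ} #0)))
      (exec (retarget (cong (λ w → config o M [] (w Vec.∷ ρ)) (+-suc x y)) (step-consume z {o = o} x)))))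
  where open +-*-Solver

within-readNumber : ∀ z {s m o M x} {ρ : Vec ℕ m} → 2 ≤ s → x ≤ s → Within s 12 z (readNumber z)
  (config (unary x ++ o) M [] (0 Vec.∷ ρ)) (config o M [] (x Vec.∷ ρ))
within-readNumber z {o = o} {M} {x} {ρ} 2≤s x≤s =
  within (constant 2≤s 1 ⊞ (constant 2≤s 5 ⊞ base 2≤s x≤s ⊠ constant 2≤s 3))
    (step-push-aux ▹ retarget (cong (λ w → config o M [] (w Vec.∷ ρ)) (+-identityʳ x)) (step-consume z x))

readMatrix : ∀ z {m} → Machine z m
readMatrix z = while out (pop out skip (push aux)) ⨾ while aux (pop aux skip (push mat))

step-unload : ∀ z {m M a} {ρ : Vec ℕ m} o → Step z (while out (pop out skip (push aux)))
  (config o M a ρ) (config [] M (o ʳ++ a) ρ) (suc (length o * 3))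
step-unload z []      = step (exec-while-empty refl)
step-unload z (s ∷ o) = step (exec-while-step refl
  (exec-pop {b = 1} refl refl (exec-push refl refl)) (exec (step-unload z o)))

within-readMatrix : ∀ z {s m} {ρ : Vec ℕ m} w → 2 ≤ s → length w ≤ s → Within s 13 z (readMatrix z)
  (config w [] [] ρ) (config [] w [] ρ)
within-readMatrix z {ρ = ρ} w 2≤s w≤s =
  within (constant 2≤s 1 ⊞ l ⊠ constant 2≤s 3 ⊞ (constant 2≤s 1 ⊞ l ⊠ constant 2≤s 3))
    (step-unload z w ▹ relax (s≤s (*-monoˡ-≤ 3 (≤-reflexive (length-reverse w))))
      (retarget (cong (λ M → config [] M [] ρ) (reverse-involutive w)) (step-restore (w ʳ++ []))))
  where l = base 2≤s w≤s

place-replicate : ∀ z {m} → place z (Vec.replicate m []) ≡ Vec.replicate (z ⊕ m) []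
place-replicate zero    = refl
place-replicate (suc z) = place-replicate z

within-outputs : ∀ {s d m w w′ M a} z {p : Machine z m} {ρ : Vec ℕ m} →
  Within s d z p (config w [] [] (Vec.replicate m 0)) (config w′ M a ρ) →
  ∃[ t ] Power s d t × Outputs p w w′ t
within-outputs {m = m} {w} {w′} {M} {a} z {p} {ρ} (within cost-power (step (t , t≤ , r))) =
  t , Power-mono ≤-refl t≤ cost-power , _ ,
  subst (λ ws → Run p (w Vec.∷ [] Vec.∷ [] Vec.∷ ws) (stacks z (config w′ M a ρ)) t)
    (trans (cong (place z) (map-replicate tally 0 m)) (place-replicate z)) r

-- Needed for the new parameter 2 k. The size 2 + x bounds the input number and is at least 2.
doubling-computable : Computable (λ x → x * 2)
doubling-computable = _ , (readNumber z ⨾ compile z P) , λ x →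
  let t , _ , outputs = within-outputs z (doubles x) in
  t , subst (λ w → Outputs _ w (unary (x * 2)) t) (++-identityʳ (unary x)) outputs
  where
  P : Prog 1
  P = numeral (var #0 ⊛ lit 2)
  z = depth P
  doubles : ∀ x → Within (2 + x) _ z (readNumber z ⨾ compile z P)
    (config (unary x ++ []) [] [] (0 Vec.∷ Vec.[])) (config (unary (x * 2)) [] [] (x Vec.∷ Vec.[]))
  doubles x = within-readNumber z h (m≤n+m x 2) ▸
    retarget-output (trans (++-identityʳ _) (run-numeral (var #0 ⊛ lit 2) [] (x Vec.∷ Vec.[])))
      (proj₂ (compile-correct P) z h (λ { zero → m≤n+m x 2 }) ≤-refl)
    where
    h : 2 ≤ 2 + x
    h = m≤m+n 2 x

Transduces : ∀ {m} → Program (suc m) → ℕ → Prog 2 → Set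
Transduces p d P = ∀ k n w {s} → 2 ≤ s → k ≤ s → n ≤ s → length w ≤ s →
  ∃[ t ] Power s d t × Outputs p (unary k ++ unary n ++ w) (run P w (n Vec.∷ k Vec.∷ Vec.[])) t

transducer : (P : Prog 2) → ∃[ m ] Σ[ p ∈ Program (suc m) ] ∃[ d ] Transduces p d P
transducer P = _ , (readNumber (suc z) ⨾ readNumber z ⨾ readMatrix z ⨾ compile z P) , _ ,
  λ k n w 2≤s k≤s n≤s w≤s →
    let bounded : ∀ i → lookup (n Vec.∷ k Vec.∷ Vec.[]) i ≤ _
        bounded = λ { zero → n≤s ; (suc zero) → k≤s }
    in within-outputs z (free (within-readNumber (suc z) 2≤s k≤s) ▸
      within-readNumber z 2≤s n≤s ▸ within-readMatrix z w 2≤s w≤s ▸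
      retarget-output (++-identityʳ _) (proj₂ (compile-correct P) z 2≤s bounded ≤-refl))
  where z = depth P

-- Subsets

record Listing {n} (S : Subset n) : Set where
  field
    member    : Fin ∣ S ∣ → Fin n
    member∈   : ∀ i → member i ∈ S
    position  : ∀ {x} → x ∈ S → Fin ∣ S ∣
    at-position : ∀ {x} (x∈S : x ∈ S) → member (position x∈S) ≡ x
    member-injective : ∀ {i j} → member i ≡ member j → i ≡ j

listing : ∀ {n} (S : Subset n) → Listing S
listing Vec.[] = record
  { member = λ () ; member∈ = λ () ; position = λ () ; at-position = λ () ; member-injective = λ { {()} } }
listing (outside Vec.∷ S) = record
  { member           = suc ∘ member
  ; member∈          = there ∘ member∈
  ; position         = λ { (there x∈S) → position x∈S }
  ; at-position      = λ { (there x∈S) → cong suc (at-position x∈S) }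
  ; member-injective = λ eq → member-injective (Fin-suc-injective eq)
  }
  where open Listing (listing S)
listing (inside Vec.∷ S) = record
  { member           = λ { zero → zero ; (suc i) → suc (member i) }
  ; member∈          = λ { zero → here ; (suc i) → there (member∈ i) }
  ; position         = λ { here → zero ; (there x∈S) → suc (position x∈S) }
  ; at-position      = λ { here → refl ; (there x∈S) → cong suc (at-position x∈S) }
  ; member-injective = λ { {zero} {zero} _ → refl ; {suc i} {suc j} eq → cong suc (member-injective (Fin-suc-injective eq)) }
  }
  where open Listing (listing S)

position-injective : ∀ {n} {S : Subset n} {x y} (x∈S : x ∈ S) (y∈S : y ∈ S) →
  Listing.position (listing S) x∈S ≡ Listing.position (listing S) y∈S → x ≡ y
position-injective {S = S} x∈S y∈S eq =
  trans (sym (at-position x∈S)) (trans (cong member eq) (at-position y∈S))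
  where open Listing (listing S)

injection⇒≤∣S∣ : ∀ {m n} {S : Subset n} (f : Fin m → Fin n) →
  (∀ {i j} → f i ≡ f j → i ≡ j) → (∀ i → f i ∈ S) → m ≤ ∣ S ∣
injection⇒≤∣S∣ {S = S} f inj f∈S =
  injective⇒≤ {f = λ i → Listing.position (listing S) (f∈S i)}
    (λ eq → inj (position-injective (f∈S _) (f∈S _) eq))

image : ∀ {m n} → (Fin m → Fin n) → Subset n
image f = Vec.tabulate λ x → does (any? λ i → f i Data.Fin.≟ x)

∈-image : ∀ {m n} (f : Fin m → Fin n) i → f i ∈ image f
∈-image f i = lookup⇒[]= (f i) _ (trans (lookup∘tabulate _ (f i)) (dec-true (any? _) (i , refl)))

image-∈ : ∀ {m n} (f : Fin m → Fin n) {x} → x ∈ image f → ∃[ i ] f i ≡ x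
image-∈ f {x} x∈ with any? (λ i → f i Data.Fin.≟ x) | trans (sym (lookup∘tabulate (λ x → does (any? λ i → f i Data.Fin.≟ x)) x)) ([]=⇒lookup x∈)
... | yes p | _  = p
... | no _  | ()

∣image∣ : ∀ {m n} (f : Fin m → Fin n) → (∀ {i j} → f i ≡ f j → i ≡ j) → ∣ image f ∣ ≡ m
∣image∣ f inj = ≤-antisym
  (injective⇒≤ {f = λ i → proj₁ (image-∈ f (member∈ i))} (λ {i} {j} eq → member-injective
    (trans (sym (proj₂ (image-∈ f (member∈ i)))) (trans (cong f eq) (proj₂ (image-∈ f (member∈ j)))))))
  (injection⇒≤∣S∣ f inj (∈-image f))
  where open Listing (listing (image f))

-- An x outside the image would extend f to m + 1 different members of S.
injection-covers : ∀ {m n} {S : Subset n} (f : Fin m → Fin n) → (∀ {i j} → f i ≡ f j → i ≡ j) →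
  (∀ i → f i ∈ S) → ∣ S ∣ ≡ m → ∀ {x} → x ∈ S → ∃[ i ] f i ≡ x
injection-covers {m} {n} {S} f inj f∈S ∣S∣≡m {x} x∈S with any? (λ i → f i Data.Fin.≟ x)
... | yes p = p
... | no ¬p = contradiction (≤-trans (injection⇒≤∣S∣ g g-injective g∈S) (≤-reflexive ∣S∣≡m)) (<-irrefl refl)
  where
  g : Fin (suc m) → Fin n
  g zero    = x
  g (suc i) = f i
  g-injective : ∀ {i j} → g i ≡ g j → i ≡ j
  g-injective {zero}  {zero}  eq = refl
  g-injective {zero}  {suc j} eq = contradiction (j , sym eq) ¬p
  g-injective {suc i} {zero}  eq = contradiction (i , eq) ¬p
  g-injective {suc i} {suc j} eq = cong suc (inj eq)
  g∈S : ∀ i → g i ∈ S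
  g∈S zero    = x∈S
  g∈S (suc i) = f∈S i

-- Finite types listed by nested loops

-- `item` and `index` number the vertices of a graph, `each` is the word printed by nested loops,
-- and `each-item` ties the loop order to the numbering.
record Enumeration (A : Set) : Set₁ where
  field
    size       : ℕ
    item       : Fin size → A
    index      : A → Fin size
    item-index : ∀ a → item (index a) ≡ a
    each       : (A → Word) → Word
    each-item  : ∀ w → concat (tabulate (w ∘ item)) ≡ each w

open Enumeration

fin : ∀ n → Enumeration (Fin n)
fin n = record
  { size = n ; item = id ; index = id ; item-index = λ _ → refl
  ; each = λ w → concat (tabulate w) ; each-item = λ _ → refl }

concat-tabulate-+ : ∀ m {n} (w : Fin (m + n) → Word) →
  concat (tabulate w) ≡ concat (tabulate (w ∘ (_↑ˡ n))) ++ concat (tabulate (w ∘ (m ↑ʳ_)))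
concat-tabulate-+ zero    w = refl
concat-tabulate-+ (suc m) w =
  trans (cong (w zero ++_) (concat-tabulate-+ m (w ∘ suc))) (sym (++-assoc (w zero) _ _))

concat-tabulate-* : ∀ m {n} (w : Fin (m * n) → Word) →
  concat (tabulate w) ≡ concat (tabulate λ i → concat (tabulate λ j → w (combine {m} {n} i j)))
concat-tabulate-* zero    w = refl
concat-tabulate-* (suc m) {n} w = trans (concat-tabulate-+ n w)
  (cong (concat (tabulate (w ∘ (_↑ˡ (m * n)))) ++_) (concat-tabulate-* m (w ∘ (n ↑ʳ_))))

infixr 2 _×ₑ_
infixr 1 _⊎ₑ_

_×ₑ_ : ∀ {A B : Set} → Enumeration A → Enumeration B → Enumeration (A × B)
_×ₑ_ {A} {B} E E′ = record
  { size       = size E * size E′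
  ; item       = item′
  ; index      = λ (a , b) → combine (index E a) (index E′ b)
  ; item-index = λ (a , b) → trans (item-combine _ _) (cong₂ _,_ (item-index E a) (item-index E′ b))
  ; each       = λ w → each E λ a → each E′ λ b → w (a , b)
  ; each-item  = λ w → trans (concat-tabulate-* (size E) (w ∘ item′))
      (trans (cong concat (tabulate-cong λ i →
        trans (cong concat (tabulate-cong λ j → cong w (item-combine i j))) (each-item E′ _)))
      (each-item E _))
  }
  where
  item′ : Fin (size E * size E′) → A × B
  item′ x = let (i , j) = remQuot {size E} (size E′) x in item E i , item E′ j
  item-combine : ∀ i j → item′ (combine i j) ≡ (item E i , item E′ j)
  item-combine i j = cong (λ (i , j) → item E i , item E′ j) (remQuot-combine i j)

_⊎ₑ_ : ∀ {A B : Set} → Enumeration A → Enumeration B → Enumeration (A ⊎ B)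
_⊎ₑ_ {A} {B} E E′ = record
  { size       = size E + size E′
  ; item       = item′
  ; index      = [ (λ a → index E a ↑ˡ size E′) , (λ b → size E ↑ʳ index E′ b) ]′
  ; item-index = λ { (inj₁ a) → trans (itemˡ _) (cong inj₁ (item-index E a))
                   ; (inj₂ b) → trans (itemʳ _) (cong inj₂ (item-index E′ b)) }
  ; each       = λ w → each E (w ∘ inj₁) ++ each E′ (w ∘ inj₂)
  ; each-item  = λ w → trans (concat-tabulate-+ (size E) (w ∘ item′))
      (cong₂ _++_
        (trans (cong concat (tabulate-cong (cong w ∘ itemˡ))) (each-item E _))
        (trans (cong concat (tabulate-cong (cong w ∘ itemʳ))) (each-item E′ _)))
  }
  where
  item′ : Fin (size E + size E′) → A ⊎ B
  item′ x = [ inj₁ ∘ item E , inj₂ ∘ item E′ ]′ (splitAt (size E) x)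
  itemˡ : ∀ i → item′ (i ↑ˡ size E′) ≡ inj₁ (item E i)
  itemˡ i rewrite splitAt-↑ˡ (size E) i (size E′) = refl
  itemʳ : ∀ i → item′ (size E ↑ʳ i) ≡ inj₂ (item E′ i)
  itemʳ i rewrite splitAt-↑ʳ (size E) (size E′) i = refl

-- The reduction

Box : Set
Box = Fin Tracks → ℕ × ℕ

Valid : Box → Set
Valid b = ∀ t → proj₁ (b t) ≤ proj₂ (b t)

Disjoint : Box → Box → Set
Disjoint b c = ∀ t → proj₂ (b t) < proj₁ (c t) ⊎ proj₂ (c t) < proj₁ (b t)

Disjoint-sym : ∀ {b c} → Disjoint b c → Disjoint c b
Disjoint-sym d t = [ inj₂ , inj₁ ]′ (d t)

toIntervals : ∀ b → Valid b → ThreeTrackInterval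
toIntervals b valid t = record { lo = proj₁ (b t) ; hi = proj₂ (b t) ; lo≤hi = valid t }

tracks : ∀ {A : Set} → A → A → A → Fin Tracks → A
tracks a b c zero             = a
tracks a b c (suc zero)       = b
tracks a b c (suc (suc zero)) = c

-- The selectable points lie in the half-open blocks of length n + 1: block
-- 2 i + h contains the n points (i , h , a).
module _ (n : ℕ) where

  W B : ℕ
  W = suc n
  B = W + W

  point : ℕ → ℕ → ℕ → ℕ
  point i h a = i * B + (h * W + suc a)

  selectBox : ℕ → ℕ → ℕ → Box
  selectBox i h a = tracks (p , p) (p , p) (p , p)
    where p = point i h a

  -- Misses exactly the points (i , 0 , a) with a < o and (i , 1 , a) with o ≤ a.
  orderBox : ℕ → ℕ → ℕ → Box
  orderBox k i o = tracks (0 , i * B) (i * B + suc o , i * B + (W + o)) (i * B + B , k * B + k * B)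

  -- For s = 1 this misses exactly the points (i , 0 , a) with a > u, (i , 1 , a)
  -- with a < u, (j , 0 , a) with a > v and (j , 1 , a) with a < v; for s = 0 it
  -- misses all points.
  pairBox : ℕ → ℕ → ℕ → ℕ → ℕ → ℕ → Box
  pairBox k s i j u v =
    tracks (0 , s * p) (s * (p + W) , s * q) (q + W + (1 ∸ s) * (k * B) , k * B + k * B)
    where
    p = i * B + suc u
    q = j * B + suc v

  next-block : ∀ {i j} → i < j → i * B + B ≤ j * B
  next-block {i} {j} i<j = ≤-trans (≤-reflexive (+-comm (i * B) B)) (*-monoˡ-≤ B i<j)

  block-unique : ∀ {i j r x} → x ≡ j * B + r → r < B → i * B < x → x < i * B + B → j ≡ i
  block-unique {i} {j} {r} refl r<B lower upper with <-cmp j i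
  ... | tri≈ _ j≡i _ = j≡i
  ... | tri< j<i _ _ = contradiction
    (<-trans lower (<-≤-trans (+-monoʳ-< (j * B) r<B) (next-block j<i))) (<-irrefl refl)
  ... | tri> _ _ i<j = contradiction
    (<-≤-trans upper (≤-trans (next-block i<j) (m≤m+n (j * B) r))) (<-irrefl refl)

  lower<B : ∀ {a} → a < n → suc a < B
  lower<B a<n = s≤s (≤-trans a<n (m≤m+n n W))

  offset<B : ∀ (h : Fin 2) {a} → a < n → toℕ h * W + suc a < B
  offset<B zero       a<n = lower<B a<n
  offset<B (suc zero) a<n = +-mono-≤-< (≤-reflexive (+-identityʳ W)) (s≤s a<n)

  point₁ : ∀ i a → point i 1 a ≡ i * B + (W + suc a)
  point₁ i a = cong (λ w → i * B + (w + suc a)) (+-identityʳ W)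

  -- The condition for a point of either half to lie in the gap of u; its failure in both halves
  -- reads a ≤ u ≤ a′.
  Misses : ℕ → Fin 2 → ℕ → Set
  Misses u zero       a = u < a
  Misses u (suc zero) a = a < u

  -- The open gap between (i , 0 , u) and (i , 1 , u); both ends are excluded, so the choice a = a′
  -- = u does not enter it.
  Window : ℕ → ℕ → ℕ → Set
  Window i u x = i * B + suc u < x × x < i * B + suc u + W

  misses⇒window : ∀ i u h {a} → u < n → a < n → Misses u h a → Window i u (point i (toℕ h) a)
  misses⇒window i u zero {a} u<n a<n u<a = +-monoʳ-< (i * B) (s≤s u<a) ,
    <-≤-trans (+-monoʳ-< (i * B) {y = suc u + W} (s≤s (≤-trans a<n (≤-trans (n≤1+n n) (m≤n+m W u)))))
      (≤-reflexive (sym (+-assoc (i * B) (suc u) W)))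
  misses⇒window i u (suc zero) {a} u<n a<n a<u = subst (Window i u) (sym (point₁ i a))
    ( +-monoʳ-< (i * B) (s≤s (≤-trans u<n (m≤m+n n (suc a))))
    , <-≤-trans (+-monoʳ-< (i * B) {y = suc u + W}
        (≤-trans (≤-reflexive (cong suc (+-comm W (suc a)))) (s≤s (+-monoˡ-≤ W a<u))))
      (≤-reflexive (sym (+-assoc (i * B) (suc u) W))))

  -- As u < n, the window stays strictly between i * B and i * B + B, which determines the block;
  -- cancelling the offset then compares a with u.
  window⇒misses : ∀ i u j h {a} → u < n → a < n → Window i u (point j (toℕ h) a) → j ≡ i × Misses u h a
  window⇒misses i u j h {a} u<n a<n (lower , upper)
    with block-unique {i} {j} refl (offset<B h a<n) (≤-<-trans (m≤m+n (i * B) (suc u)) lower)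
           (<-≤-trans upper (≤-trans (≤-reflexive (+-assoc (i * B) (suc u) W))
             (+-monoʳ-≤ (i * B) (s≤s (+-monoˡ-≤ W (<⇒≤ u<n))))))
  window⇒misses i u j zero {a} u<n a<n (lower , upper) | refl =
    refl , s<s⁻¹ (+-cancelˡ-< (i * B) (suc u) (suc a) lower)
  window⇒misses i u j (suc zero) {a} u<n a<n (lower , upper) | refl =
    refl , s<s⁻¹ (+-cancelˡ-< W (suc a) (suc u) (subst (W + suc a <_) (+-comm (suc u) W)
      (+-cancelˡ-< (i * B) (W + suc a) (suc u + W)
        (subst₂ _<_ (point₁ i a) (+-assoc (i * B) (suc u) W) upper))))

  point≤ : ∀ {k i a} (h : Fin 2) → i < k → a < n → point i (toℕ h) a ≤ k * B
  point≤ {i = i} h i<k a<n = ≤-trans (+-monoʳ-≤ (i * B) (<⇒≤ (offset<B h a<n))) (next-block i<k)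

  Avoids : ℕ → Fin 2 → ℕ → Set
  Avoids o zero       a = a < o
  Avoids o (suc zero) a = o ≤ a

  avoids⇒disjoint : ∀ {k i o} h {a} → a < n → Avoids o h a →
    Disjoint (orderBox k i o) (selectBox i (toℕ h) a)
  avoids⇒disjoint {i = i} h a<n av zero =
    inj₁ (≤-<-trans (≤-reflexive (sym (+-identityʳ (i * B)))) (+-monoʳ-< (i * B) (positive h)))
    where
    positive : ∀ (h : Fin 2) {a} → 0 < toℕ h * W + suc a
    positive h {a} = <-≤-trans z<s (m≤n+m (suc a) (toℕ h * W))
  avoids⇒disjoint {i = i} zero       a<n a<o (suc zero) = inj₂ (+-monoʳ-< (i * B) (s≤s a<o))
  avoids⇒disjoint {i = i} {o} (suc zero) {a} a<n o≤a (suc zero) = inj₁ (subst (i * B + (W + o) <_) (sym (point₁ i a))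
    (+-monoʳ-< (i * B) (+-monoʳ-< W (s≤s o≤a))))
  avoids⇒disjoint {i = i} h a<n av (suc (suc zero)) = inj₂ (+-monoʳ-< (i * B) (offset<B h a<n))

  -- The first track puts the point after i * B, the third before i * B + B, since no point lies
  -- beyond k * B + k * B; this fixes the block. The middle track then decides the comparison with
  -- o.
  disjoint⇒avoids : ∀ {k i o j} h {a} → o ≤ n → j < k → a < n →
    Disjoint (orderBox k i o) (selectBox j (toℕ h) a) → j ≡ i × Avoids o h a
  disjoint⇒avoids {k} {i} {o} {j} h {a} o≤n j<k a<n disjoint with disjoint zero | disjoint (suc (suc zero))
  ... | inj₁ lower | inj₁ beyond = contradiction
    (<-≤-trans beyond (≤-trans (point≤ h j<k a<n) (m≤m+n (k * B) (k * B)))) (<-irrefl refl)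
  ... | inj₁ lower | inj₂ upper with block-unique {i} {j} refl (offset<B h a<n) lower upper
  ...   | refl = refl , side h a<n (disjoint (suc zero))
    where
    side : ∀ h {a} → a < n → i * B + (W + o) < point i (toℕ h) a ⊎ point i (toℕ h) a < i * B + suc o → Avoids o h a
    side zero {a} a<n (inj₂ lt) = s<s⁻¹ (+-cancelˡ-< (i * B) (suc a) (suc o) lt)
    side zero {a} a<n (inj₁ lt) = contradiction
      (<-trans (+-cancelˡ-< (i * B) (W + o) (suc a) lt) (s≤s (≤-trans a<n (m≤m+n n o)))) (<-irrefl refl)
    side (suc zero) {a} a<n (inj₁ lt) = s≤s⁻¹ (+-cancelˡ-< W o (suc a)
      (+-cancelˡ-< (i * B) (W + o) (W + suc a) (subst (i * B + (W + o) <_) (point₁ i a) lt)))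
    side (suc zero) {a} a<n (inj₂ lt) = contradiction
      (<-≤-trans (+-cancelˡ-< (i * B) (W + suc a) (suc o) (subst (_< i * B + suc o) (point₁ i a) lt))
        (≤-trans (s≤s o≤n) (m≤m+n W (suc a)))) (<-irrefl refl)

  halves-disjoint : ∀ i a b → a < n → Disjoint (selectBox i 0 a) (selectBox i 1 b)
  halves-disjoint i a b a<n = λ { zero → inj₁ lt ; (suc zero) → inj₁ lt ; (suc (suc zero)) → inj₁ lt }
    where
    lt : point i 0 a < point i 1 b
    lt = +-monoʳ-< (i * B) (<-≤-trans (s≤s a<n) (≤-trans (m≤m+n W 0) (m≤m+n (W + 0) (suc b))))

  -- For s = 0 the first two tracks shrink to 0, below every point, and the third starts beyond k *
  -- B, above every point. The right end k * B + k * B of the gap vertices leaves room for this.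
  idle-disjoint : ∀ {k i j u v i′ a} (h : Fin 2) → i′ < k → a < n →
    Disjoint (pairBox k 0 i j u v) (selectBox i′ (toℕ h) a)
  idle-disjoint {k} {j = j} {v = v} {i′} {a} h i′<k a<n =
    λ { zero → inj₁ positive ; (suc zero) → inj₁ positive
      ; (suc (suc zero)) → inj₂ (≤-<-trans (point≤ h i′<k a<n)
          (+-mono-<-≤ {0} (≤-trans (s≤s z≤n) (m≤n+m W (j * B + suc v))) (≤-reflexive (sym (+-identityʳ (k * B)))))) }
    where
    positive : 0 < point i′ (toℕ h) a
    positive = <-≤-trans z<s (≤-trans (m≤n+m (suc a) (toℕ h * W)) (m≤n+m _ (i′ * B)))

  -- Makes the middle interval of `pairBox` nonempty.
  windows-apart : ∀ {i j u} v → i < j → u < n → i * B + suc u + W ≤ j * B + suc v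
  windows-apart {i} {j} {u} v i<j u<n = begin
    i * B + suc u + W   ≡⟨ +-assoc (i * B) (suc u) W ⟩
    i * B + (suc u + W) ≤⟨ +-monoʳ-≤ (i * B) (s≤s (+-monoˡ-≤ W (<⇒≤ u<n))) ⟩
    i * B + B           ≤⟨ next-block i<j ⟩
    j * B               ≤⟨ m≤m+n (j * B) (suc v) ⟩
    j * B + suc v       ∎
    where open ≤-Reasoning

  windows⇒disjoint : ∀ {k i j u v i′ a} (h : Fin 2) → i < j → u < n →
    let x = point i′ (toℕ h) a in Window i u x ⊎ Window j v x →
    Disjoint (pairBox k 1 i j u v) (selectBox i′ (toℕ h) a)
  windows⇒disjoint {k} {i} {j} {u} {v} {i′} {a} h i<j u<n = go
    where
    p = i * B + suc u
    q = j * B + suc v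
    x = point i′ (toℕ h) a
    p+W≤q : p + W ≤ q
    p+W≤q = windows-apart v i<j u<n
    go : Window i u x ⊎ Window j v x → Disjoint (pairBox k 1 i j u v) (selectBox i′ (toℕ h) a)
    go (inj₁ (lower , upper)) zero = inj₁ (subst (_< x) (sym (+-identityʳ p)) lower)
    go (inj₁ (lower , upper)) (suc zero) = inj₂ (subst (x <_) (sym (+-identityʳ (p + W))) upper)
    go (inj₁ (lower , upper)) (suc (suc zero)) =
      inj₂ (<-≤-trans upper (≤-trans p+W≤q (≤-trans (m≤m+n q W) (m≤m+n (q + W) 0))))
    go (inj₂ (lower , upper)) zero =
      inj₁ (subst (_< x) (sym (+-identityʳ p)) (≤-<-trans (≤-trans (m≤m+n p W) p+W≤q) lower))
    go (inj₂ (lower , upper)) (suc zero) = inj₁ (subst (_< x) (sym (+-identityʳ q)) lower)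
    go (inj₂ (lower , upper)) (suc (suc zero)) = inj₂ (<-≤-trans upper (m≤m+n (q + W) 0))

  disjoint⇒windows : ∀ {k i j u v i′ a} (h : Fin 2) → i′ < k → a < n →
    let x = point i′ (toℕ h) a in
    Disjoint (pairBox k 1 i j u v) (selectBox i′ (toℕ h) a) → Window i u x ⊎ Window j v x
  disjoint⇒windows {k} {i} {j} {u} {v} {i′} {a} h i′<k a<n disjoint
    with disjoint zero | disjoint (suc zero) | disjoint (suc (suc zero))
  ... | _ | _ | inj₁ beyond = contradiction
    (<-≤-trans beyond (≤-trans (point≤ h i′<k a<n) (m≤m+n (k * B) (k * B)))) (<-irrefl refl)
  ... | inj₁ lower | inj₂ upper | _ =
    inj₁ (subst (_< point i′ (toℕ h) a) (+-identityʳ _) lower , subst (point i′ (toℕ h) a <_) (+-identityʳ _) upper)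
  ... | _ | inj₁ lower | inj₂ upper =
    inj₂ (subst (_< point i′ (toℕ h) a) (+-identityʳ _) lower , subst (point i′ (toℕ h) a <_) (+-identityʳ _) upper)

  selectBox-valid : ∀ i h a → Valid (selectBox i h a)
  selectBox-valid i h a = λ { zero → ≤-refl ; (suc zero) → ≤-refl ; (suc (suc zero)) → ≤-refl }

  orderBox-valid : ∀ {k i} o → i < k → Valid (orderBox k i o)
  orderBox-valid {k} {i} o i<k = λ
    { zero → z≤n
    ; (suc zero) → +-monoʳ-≤ (i * B) (s≤s (m≤n+m o n))
    ; (suc (suc zero)) → ≤-trans (next-block i<k) (m≤m+n (k * B) (k * B)) }

  pairBox-valid : ∀ {k s i j u v} → s ≡ 0 ⊎ s ≡ 1 × i < j → u < n → v < n → j < k → Valid (pairBox k s i j u v)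
  pairBox-valid _ _ _ _ zero = z≤n
  pairBox-valid (inj₁ refl) _ _ _ (suc zero) = z≤n
  pairBox-valid {v = v} (inj₂ (refl , i<j)) u<n _ _ (suc zero) = +-monoˡ-≤ 0 (windows-apart v i<j u<n)
  pairBox-valid {k} {s} {j = j} {v = v} _ _ v<n j<k (suc (suc zero)) = +-mono-≤
    (≤-trans (≤-reflexive (+-assoc (j * B) (suc v) W))
      (≤-trans (+-monoʳ-≤ (j * B) (s≤s (+-monoˡ-≤ W (<⇒≤ v<n)))) (next-block j<k)))
    (≤-trans (*-monoˡ-≤ (k * B) (m∸n≤m 1 s)) (≤-reflexive (+-identityʳ (k * B))))

-- The indicator of i < j together with e = 0, written in the operations of the loop language so
-- that `pairExp` can compute it.
active : ℕ → ℕ → ℕ → ℕ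
active i j e = (1 ∸ (1 ∸ (j ∸ i))) * (1 ∸ e)

active-cases : ∀ i j e → active i j e ≡ 0 ⊎ active i j e ≡ 1 × i < j × e ≡ 0
active-cases i j e with i <? j
active-cases i j zero    | yes i<j with j ∸ i | m<n⇒0<n∸m i<j
... | suc d | _ = inj₂ (cong (λ x → (1 ∸ x) * 1) (0∸n≡0 d) , i<j , refl)
active-cases i j (suc e) | yes i<j =
  inj₁ (trans (cong ((1 ∸ (1 ∸ (j ∸ i))) *_) (0∸n≡0 e)) (*-zeroʳ (1 ∸ (1 ∸ (j ∸ i)))))
active-cases i j e       | no i≮j  =
  inj₁ (cong (λ d → (1 ∸ (1 ∸ d)) * (1 ∸ e)) (m≤n⇒m∸n≡0 (≮⇒≥ i≮j)))

value≡0 : ∀ {b} → value b ≡ 0 → ¬ T b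
value≡0 {true} ()

active-nonadjacent : ∀ {i j} → i < j → active i j 0 ≡ 1
active-nonadjacent {i} {j} i<j with j ∸ i | m<n⇒0<n∸m i<j
... | suc d | _ = cong (λ x → (1 ∸ x) * 1) (0∸n≡0 d)

Vertex : ℕ → ℕ → Set
Vertex k n = (Fin k × Fin 2 × Fin n) ⊎ (Fin k × Fin (suc n)) ⊎ (Fin k × Fin k × Fin n × Fin n)

pattern select i h a  = inj₁ (i , h , a)
pattern order i o     = inj₂ (inj₁ (i , o))
pattern pair i j u v  = inj₂ (inj₂ (i , j , u , v))

opaque
  -- Opaque, so that the graph arguments see only the interface of an enumeration. Summands and
  -- factors follow the loops of `forVertices`.
  vertices : ∀ k n → Enumeration (Vertex k n)
  vertices k n =
    (fin k ×ₑ fin 2 ×ₑ fin n) ⊎ₑ (fin k ×ₑ fin (suc n)) ⊎ₑ (fin k ×ₑ fin k ×ₑ fin n ×ₑ fin n)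

  size-vertices-0 : ∀ k → size (vertices k 0) ≡ k
  size-vertices-0 k = trans
    (cong₂ (λ x y → x + (k * 1 + y)) (*-zeroʳ k) (trans (cong (k *_) (*-zeroʳ k)) (*-zeroʳ k)))
    (trans (+-identityʳ (k * 1)) (*-identityʳ k))

complement-adj⇒ : ∀ {P Q : Set} (d : Dec P) (e : Dec Q) →
  T (not (does d) ∧ not (not (does d) ∧ does e)) → ¬ Q
complement-adj⇒ (no _) (no ¬q) _ = ¬q

⇒complement-adj : ∀ {P Q : Set} (d : Dec P) (e : Dec Q) → (P → Q) → ¬ Q →
  T (not (does d) ∧ not (not (does d) ∧ does e))
⇒complement-adj (yes p) _       p⇒q ¬q = contradiction (p⇒q p) ¬q
⇒complement-adj (no _)  (yes q) _   ¬q = contradiction q ¬q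
⇒complement-adj (no _)  (no _)  _   _  = tt

¬intersects⇒disjoint : ∀ b c (v : Valid b) (w : Valid c) →
  ¬ Intersects (toIntervals b v) (toIntervals c w) → Disjoint b c
¬intersects⇒disjoint b c v w ¬meet t with proj₁ (c t) ≤? proj₂ (b t) | proj₁ (b t) ≤? proj₂ (c t)
... | no gap  | _       = inj₁ (≰⇒> gap)
... | yes _   | no gap  = inj₂ (≰⇒> gap)
... | yes c≤b | yes b≤c = contradiction
  ( (t , proj₁ (b t) ⊔ proj₁ (c t))
  , (m≤m⊔n _ _ , ⊔-lub (v t) c≤b) , (m≤n⊔m (proj₁ (b t)) _ , ⊔-lub b≤c (w t))) ¬meet

disjoint⇒¬intersects : ∀ b c (v : Valid b) (w : Valid c) →
  Disjoint b c → ¬ Intersects (toIntervals b v) (toIntervals c w)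
disjoint⇒¬intersects b c v w disjoint ((t , _) , (lb , hb) , (lc , hc)) with disjoint t
... | inj₁ b<c = contradiction (<-≤-trans b<c (≤-trans lc hb)) (<-irrefl refl)
... | inj₂ c<b = contradiction (<-≤-trans c<b (≤-trans lb hc)) (<-irrefl refl)

module _ {N : ℕ} (b : Fin N → Box) (valid : ∀ x → Valid (b x)) where

  box-intervals : Fin N → ThreeTrackInterval
  box-intervals x = toIntervals (b x) (valid x)

  boxGraph : Graph N
  boxGraph = complement (intersectionGraph box-intervals)

  adj⇒disjoint : ∀ x y → Adj boxGraph x y → Disjoint (b x) (b y)
  adj⇒disjoint x y x~y = ¬intersects⇒disjoint (b x) (b y) (valid x) (valid y)
    (complement-adj⇒ (x Data.Fin.≟ y) (intersects? (box-intervals x) (box-intervals y)) x~y)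

  disjoint⇒adj : ∀ x y → Disjoint (b x) (b y) → Adj boxGraph x y
  disjoint⇒adj x y disjoint = ⇒complement-adj (x Data.Fin.≟ y) (intersects? (box-intervals x) (box-intervals y))
    (λ { refl → (zero , _) , (≤-refl , valid x zero) , (≤-refl , valid x zero) })
    (disjoint⇒¬intersects (b x) (b y) (valid x) (valid y) disjoint)

-- The reduced graph

module _ {n : ℕ} (G : Graph n) (k : ℕ) where

  entry : Fin n → Fin n → ℕ
  entry u v = value (adj G u v)

  box : Vertex k n → Box
  box (select i h a) = selectBox n (toℕ i) (toℕ h) (toℕ a)
  box (order i o)    = orderBox n k (toℕ i) (toℕ o)
  box (pair i j u v) =
    pairBox n k (active (toℕ i) (toℕ j) (entry u v)) (toℕ i) (toℕ j) (toℕ u) (toℕ v)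

  box-valid : ∀ x → Valid (box x)
  box-valid (select i h a) = selectBox-valid n (toℕ i) (toℕ h) (toℕ a)
  box-valid (order i o)    = orderBox-valid n (toℕ o) (toℕ<n i)
  box-valid (pair i j u v) =
    pairBox-valid n (Data.Sum.map₂ (λ (eq , i<j , _) → eq , i<j) (active-cases (toℕ i) (toℕ j) (entry u v))) (toℕ<n u) (toℕ<n v) (toℕ<n j)

  intervals : Vertex k n → ThreeTrackInterval
  intervals x = toIntervals (box x) (box-valid x)

  ∣V∣ : ℕ
  ∣V∣ = size (vertices k n)

  vertex : Fin ∣V∣ → Vertex k n
  vertex = item (vertices k n)

  family : Fin ∣V∣ → ThreeTrackInterval
  family = intervals ∘ vertex

  reducedGraph : Graph ∣V∣
  reducedGraph = complement (intersectionGraph family)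

  Apart : Fin ∣V∣ → Fin ∣V∣ → Set
  Apart x y = Disjoint (box (vertex x)) (box (vertex y))

  adjacent⇒apart : ∀ x y → Adj reducedGraph x y → Apart x y
  adjacent⇒apart = adj⇒disjoint (box ∘ vertex) (box-valid ∘ vertex)

  apart⇒adjacent : ∀ x y → Apart x y → Adj reducedGraph x y
  apart⇒adjacent = disjoint⇒adj (box ∘ vertex) (box-valid ∘ vertex)

  -- From a clique to a dominating set

  CliqueSequence : Set
  CliqueSequence = Σ[ a ∈ (Fin k → Fin n) ] (∀ {i j} → i ≢ j → Adj G (a i) (a j))

  clique⇒sequence : (∃[ S ] ∣ S ∣ ≡ k × IsClique G S) → CliqueSequence
  clique⇒sequence (S , refl , clique) = member , λ {i} {j} i≢j →
    clique (member i) (member j) (member∈ i) (member∈ j) (λ eq → i≢j (member-injective eq))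
    where open Listing (listing S)

  sequence⇒clique : CliqueSequence → ∃[ S ] ∣ S ∣ ≡ k × IsClique G S
  sequence⇒clique (a , clique) = image a , ∣image∣ a injective , λ u v u∈ v∈ u≢v →
    let (i , aᵢ≡u) = image-∈ a u∈ ; (j , aⱼ≡v) = image-∈ a v∈ in
    subst₂ (Adj G) aᵢ≡u aⱼ≡v (clique λ i≡j → u≢v (trans (sym aᵢ≡u) (trans (cong a i≡j) aⱼ≡v)))
    where
    injective : ∀ {i j} → a i ≡ a j → i ≡ j
    injective {i} {j} aᵢ≡aⱼ with i Data.Fin.≟ j
    ... | yes i≡j = i≡j
    ... | no i≢j  = contradiction (subst T (trans (cong (adj G (a i)) (sym aᵢ≡aⱼ)) (adj-irrefl G (a i))) (clique i≢j)) id

  DominatingSet : Set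
  DominatingSet = ∃[ D ] ∣ D ∣ ≡ k * 2 × IsDominating reducedGraph D

  module _ (a : Fin k → Fin n) (clique : ∀ {i j} → i ≢ j → Adj G (a i) (a j)) where

    chosen : Fin (k * 2) → Fin ∣V∣
    chosen x = let (i , h) = remQuot {k} 2 x in index (vertices k n) (select i h (a i))

    chosen-combine : ∀ i h → vertex (chosen (combine i h)) ≡ select i h (a i)
    chosen-combine i h = trans (item-index (vertices k n) _)
      (cong (λ (i , h) → select i h (a i)) (remQuot-combine i h))

    chosen-injective : ∀ {x y} → chosen x ≡ chosen y → x ≡ y
    chosen-injective {x} {y} eq = begin
      x                                        ≡⟨ combine-remQuot {k} 2 x ⟨
      -- Only selected points occur here; `x` is a filler for the other vertices.
      (let (i , h) = remQuot {k} 2 x in combine i h) ≡⟨ cong (λ { (select i h _) → combine i h ; _ → x }) select-eq ⟩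
      (let (i , h) = remQuot {k} 2 y in combine i h) ≡⟨ combine-remQuot {k} 2 y ⟩
      y                                        ∎
      where
      open ≡-Reasoning
      select-eq : _≡_ {A = Vertex k n} _ _
      select-eq = trans (sym (item-index (vertices k n) _)) (trans (cong vertex eq) (item-index (vertices k n) _))

    dominator : ∀ x i h → Disjoint (box (vertex x)) (box (select i h (a i))) →
      ∃[ y ] y ∈ image chosen × Adj reducedGraph x y
    dominator x i h disjoint = _ , ∈-image chosen (combine i h) ,
      apart⇒adjacent x _ (subst (Disjoint (box (vertex x)) ∘ box) (sym (chosen-combine i h)) disjoint)

    -- A point is dominated by the choice in the other half, an order vertex by the half that the
    -- comparison of a i with o selects, and an idle pair by any point. For a busy pair a i ≠ u or a
    -- j ≠ v, as the chosen vertices are adjacent, and a value different from u lies on one side of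
    -- it, hence in the window for one of the halves.
    dominated-by : ∀ x → ∃[ i ] ∃[ h ] Disjoint (box x) (box (select i h (a i)))
    dominated-by (select i zero b)       = i , suc zero , halves-disjoint n (toℕ i) (toℕ b) _ (toℕ<n b)
    dominated-by (select i (suc zero) b) = i , zero ,
      Disjoint-sym (halves-disjoint n (toℕ i) (toℕ (a i)) (toℕ b) (toℕ<n (a i)))
    dominated-by (order i o) with toℕ (a i) <? toℕ o
    ... | yes a<o = i , zero , avoids⇒disjoint n {k} {toℕ i} {toℕ o} zero (toℕ<n (a i)) a<o
    ... | no a≮o  = i , suc zero , avoids⇒disjoint n {k} {toℕ i} {toℕ o} (suc zero) (toℕ<n (a i)) (≮⇒≥ a≮o)
    dominated-by (pair i j u v) with active-cases (toℕ i) (toℕ j) (entry u v)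
    ... | inj₁ idle = i , zero ,
      subst (λ s → Disjoint (pairBox n k s (toℕ i) (toℕ j) (toℕ u) (toℕ v)) (box (select i zero (a i)))) (sym idle)
        (idle-disjoint n {k} {toℕ i} {toℕ j} {toℕ u} {toℕ v} zero (toℕ<n i) (toℕ<n (a i)))
    ... | inj₂ (busy , i<j , nonadjacent) = subst Goal (sym busy) (dominated (a i Data.Fin.≟ u) (a j Data.Fin.≟ v))
      where
      Goal : ℕ → Set
      Goal s = ∃[ i′ ] ∃[ h ] Disjoint (pairBox n k s (toℕ i) (toℕ j) (toℕ u) (toℕ v)) (box (select i′ h (a i′)))
      miss : ∀ i′ w → a i′ ≢ w → ∃[ h ] Misses n (toℕ w) h (toℕ (a i′))
      miss i′ w ≢w with <-cmp (toℕ (a i′)) (toℕ w)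
      ... | tri< a<w _ _ = suc zero , a<w
      ... | tri≈ _ a≡w _ = contradiction (toℕ-injective a≡w) ≢w
      ... | tri> _ _ w<a = zero , w<a
      window : ∀ i′ w → a i′ ≢ w →
        (∀ {x} → Window n (toℕ i′) (toℕ w) x → Window n (toℕ i) (toℕ u) x ⊎ Window n (toℕ j) (toℕ v) x) → Goal 1
      window i′ w ≢w either = let (h , m) = miss i′ w ≢w in i′ , h ,
        windows⇒disjoint n {k} {toℕ i} {toℕ j} {toℕ u} {toℕ v} {toℕ i′} {toℕ (a i′)} h i<j (toℕ<n u)
          (either (misses⇒window n (toℕ i′) (toℕ w) h (toℕ<n w) (toℕ<n (a i′)) m))
      dominated : Dec (a i ≡ u) → Dec (a j ≡ v) → Goal 1
      dominated (no aᵢ≢u)  _          = window i u aᵢ≢u inj₁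
      dominated (yes _)    (no aⱼ≢v)  = window j v aⱼ≢v inj₂
      dominated (yes refl) (yes refl) =
        contradiction (clique {i} {j} (λ { refl → <-irrefl refl i<j })) (value≡0 nonadjacent)

    image-dominating : IsDominating reducedGraph (image chosen)
    image-dominating x with dominated-by (vertex x)
    ... | i , h , disjoint = inj₂ (dominator x i h disjoint)

    sequence⇒dominating : DominatingSet
    sequence⇒dominating = image chosen , ∣image∣ chosen chosen-injective , image-dominating

-- From a dominating set to a clique

halve : ∀ {k} → k * 2 ≤ k → k ≡ 0
halve {zero}  _ = refl
halve {suc k} h = contradiction (≤-trans (s≤s (s≤s (m≤m*n k 2))) h) (<-irrefl refl)

module _ {m : ℕ} (G : Graph (suc m)) (k : ℕ) (D : Subset (∣V∣ G k)) (∣D∣≡2k : ∣ D ∣ ≡ k * 2)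
  (dominating : IsDominating (reducedGraph G k) D) where

  n = suc m

  Has : (Vertex k n → Set) → Set
  Has P = ∃[ w ] w ∈ D × P (vertex G k w)

  dominator-of : ∀ x → Has (_≡ x) ⊎ Has (λ y → Disjoint (box G k x) (box G k y))
  dominator-of x with dominating (index (vertices k n) x)
  ... | inj₁ x∈D           = inj₁ (_ , x∈D , item-index (vertices k n) x)
  ... | inj₂ (w , w∈D , a) = inj₂ (w , w∈D , subst (λ x → Disjoint (box G k x) _)
    (item-index (vertices k n) x) (adjacent⇒apart G k _ w a))

  Hits : Fin k → (Fin 2 → ℕ → Set) → Vertex k n → Set
  Hits i P x = ∃[ h ] ∃[ a ] x ≡ select i h a × P h (toℕ a)

  -- Such boxes share 0 on the first track; this is why gap vertices do not dominate each other.
  both-start-at-0 : ∀ {b c : Box} → proj₁ (b zero) ≡ 0 → proj₁ (c zero) ≡ 0 → ¬ Disjoint b c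
  both-start-at-0 b₀ c₀ disjoint with disjoint zero
  ... | inj₁ lt with () ← subst (_ <_) c₀ lt
  ... | inj₂ lt with () ← subst (_ <_) b₀ lt

  order-hit : ∀ i o → Has (_≡ order i o) ⊎ Has (Hits i (Avoids n (toℕ o)))
  order-hit i o with dominator-of (order i o)
  ... | inj₁ has = inj₁ has
  ... | inj₂ (w , w∈D , disjoint) = inj₂ (w , w∈D , hit (vertex G k w) disjoint)
    where
    hit : ∀ y → Disjoint (box G k (order i o)) (box G k y) → Hits i (Avoids n (toℕ o)) y
    hit (select j h a) d
      with disjoint⇒avoids n {k} {toℕ i} {toℕ o} {toℕ j} h (s≤s⁻¹ (toℕ<n o)) (toℕ<n j) (toℕ<n a) d
    ... | j≡i , avoids = h , a , cong (λ j → select j h a) (toℕ-injective j≡i) , avoids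
    hit (order j p)    d = contradiction d (both-start-at-0 {box G k (order i o)} {box G k (order j p)} refl refl)
    hit (pair j l u v) d = contradiction d (both-start-at-0 {box G k (order i o)} {box G k (pair j l u v)} refl refl)

  pair-hit : ∀ i j u v → toℕ i < toℕ j → adj G u v ≡ false →
    Has (_≡ pair i j u v) ⊎ Has (Hits i (Misses n (toℕ u))) ⊎ Has (Hits j (Misses n (toℕ v)))
  pair-hit i j u v i<j nonadjacent with dominator-of (pair i j u v)
  ... | inj₁ has = inj₁ has
  ... | inj₂ (w , w∈D , disjoint) =
    inj₂ (Data.Sum.map (λ h → w , w∈D , h) (λ h → w , w∈D , h) (hit (vertex G k w) disjoint))
    where
    hit : ∀ y → Disjoint (box G k (pair i j u v)) (box G k y) →
      Hits i (Misses n (toℕ u)) y ⊎ Hits j (Misses n (toℕ v)) y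
    hit (select l h a) d with disjoint⇒windows n {k} {toℕ i} {toℕ j} {toℕ u} {toℕ v} {toℕ l} h (toℕ<n l) (toℕ<n a)
      (subst (λ s → Disjoint (pairBox n k s (toℕ i) (toℕ j) (toℕ u) (toℕ v)) (box G k (select l h a)))
        (trans (cong (active (toℕ i) (toℕ j) ∘ value) nonadjacent) (active-nonadjacent i<j)) d)
    ... | inj₁ window = let (l≡i , misses) = window⇒misses n (toℕ i) (toℕ u) (toℕ l) h (toℕ<n u) (toℕ<n a) window in
      inj₁ (h , a , cong (λ l → select l h a) (toℕ-injective l≡i) , misses)
    ... | inj₂ window = let (l≡j , misses) = window⇒misses n (toℕ j) (toℕ v) (toℕ l) h (toℕ<n v) (toℕ<n a) window in
      inj₂ (h , a , cong (λ l → select l h a) (toℕ-injective l≡j) , misses)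
    hit (order l p)    d = contradiction d (both-start-at-0 {box G k (pair i j u v)} {box G k (order l p)} refl refl)
    hit (pair l l′ a b) d = contradiction d (both-start-at-0 {box G k (pair i j u v)} {box G k (pair l l′ a b)} refl refl)

  -- With o = n the gaps contain points of half 0 only, with o = 0 points of half 1 only.
  end : Fin 2 → Fin (suc n)
  end zero       = fromℕ n
  end (suc zero) = zero

  block : Vertex k n → Fin k
  block (select i h a) = i
  block (order i o)    = i
  block (pair i j u v) = i

  half : Vertex k n → Fin 2
  half (select i h a)    = h
  half (order i zero)    = suc zero
  half (order i (suc o)) = zero
  half (pair i j u v)    = zero

  -- Tells the representatives apart, by its value (i , h) on all of `Shape i h`.
  tag : Vertex k n → Fin k × Fin 2
  tag x = block x , half x

  -- What must be in D on behalf of (i , h): a point of that half-block, or the order vertex that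
  -- only such points dominate.
  data Shape (i : Fin k) (h : Fin 2) : Vertex k n → Set where
    selected : ∀ a → Shape i h (select i h a)
    ordered  : Shape i h (order i (end h))

  tag-shape : ∀ {i h x} → Shape i h x → tag x ≡ (i , h)
  tag-shape (selected a)         = refl
  tag-shape {h = zero}     ordered = refl
  tag-shape {h = suc zero} ordered = refl

  representative : ∀ i h → Has (Shape i h)
  representative i h with order-hit i (end h)
  ... | inj₁ (w , w∈D , eq) = w , w∈D , subst (Shape i h) (sym eq) ordered
  ... | inj₂ (w , w∈D , h′ , a , eq , avoids) = w , w∈D , subst (Shape i h) (sym eq) (shape h h′ avoids)
    where
    shape : ∀ h h′ → Avoids n (toℕ (end h)) h′ (toℕ a) → Shape i h (select i h′ a)
    shape zero       zero       _ = selected a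
    shape (suc zero) (suc zero) _ = selected a
    shape zero       (suc zero) n≤a = contradiction
      (<-≤-trans (toℕ<n a) (≤-trans (≤-reflexive (sym (toℕ-fromℕ n))) n≤a)) (<-irrefl refl)
    shape (suc zero) zero ()

  R : Fin k → Fin 2 → Vertex k n
  R i h = vertex G k (proj₁ (representative i h))

  shape : ∀ i h → Shape i h (R i h)
  shape i h = proj₂ (proj₂ (representative i h))

  -- D has only 2 k elements, and the representatives have different tags.
  only-representatives : ∀ P → Has P → ∃[ i ] ∃[ h ] P (R i h)
  only-representatives P (w , w∈D , p) =
    let (x , eq) = injection-covers rep rep-injective (λ x → proj₁ (proj₂ (representative _ _))) ∣D∣≡2k w∈D in
    _ , _ , subst (P ∘ vertex G k) (sym eq) p
    where
    rep : Fin (k * 2) → Fin (∣V∣ G k)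
    rep x = let (i , h) = remQuot {k} 2 x in proj₁ (representative i h)
    tag-rep : ∀ x → tag (vertex G k (rep x)) ≡ remQuot {k} 2 x
    tag-rep x = let (i , h) = remQuot {k} 2 x in tag-shape (shape i h)
    rep-injective : ∀ {x y} → rep x ≡ rep y → x ≡ y
    rep-injective {x} {y} eq = trans (sym (combine-remQuot {k} 2 x)) (trans
      (cong (λ (i , h) → combine i h)
        (trans (sym (tag-rep x)) (trans (cong (tag ∘ vertex G k) eq) (tag-rep y))))
      (combine-remQuot {k} 2 y))

  has-select : ∀ {i P} → Has (Hits i P) → ∃[ h ] ∃[ a ] R i h ≡ select i h a × P h (toℕ a)
  has-select {i} {P} has with only-representatives (Hits i P) has
  ... | i′ , h′ , h , a , eq , p with trans (sym (tag-shape (shape i′ h′))) (cong tag eq)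
  ...   | refl = h , a , eq , p

  -- No point of D in block i lies in the gap of u, so block i does not help to dominate a pair
  -- vertex with u.
  Unhit : Fin k → Fin n → Set
  Unhit i u = ∀ h a → R i h ≡ select i h a → ¬ Misses n (toℕ u) h (toℕ a)

  not-selected : ∀ {i h} {x : Vertex k n} {a} → x ≡ order i (end h) → x ≢ select i h a
  not-selected refl ()

  same-selected : ∀ {i} {h : Fin 2} {x : Vertex k n} {a c} → x ≡ select i h a → x ≡ select i h c → a ≡ c
  same-selected refl refl = refl

  tag-representative : ∀ x → Has (_≡ x) → R (proj₁ (tag x)) (proj₂ (tag x)) ≡ x
  tag-representative x has with only-representatives (_≡ x) has
  ... | i , h , eq = trans (cong (λ (i , h) → R i h) (trans (sym (cong tag eq)) (tag-shape (shape i h)))) eq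

  -- A single selected point serves as u itself. If both halves have points a and b, the order
  -- vertex with o = a is not in D, as both representatives of block i are points; it is not
  -- dominated by a, since a < a fails, so it is dominated by b, whence a ≤ b and u = a works.
  unhit : ∀ i → ∃[ u ] Unhit i u
  unhit i = pick (shape i zero) (shape i (suc zero)) refl refl
    where
    pick : ∀ {x y} → Shape i zero x → Shape i (suc zero) y → R i zero ≡ x → R i (suc zero) ≡ y → ∃[ u ] Unhit i u
    -- No point of the block is selected, so any u does; one exists because n is positive here.
    pick ordered      ordered      x≡ y≡ = zero , λ
      { zero       c c≡ _ → not-selected x≡ c≡
      ; (suc zero) c c≡ _ → not-selected {i} {suc zero} y≡ c≡ }
    pick ordered      (selected b) x≡ y≡ = b , λ
      { zero       c c≡ _   → not-selected x≡ c≡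
      ; (suc zero) c c≡ c<b → <-irrefl (cong toℕ (sym (same-selected y≡ c≡))) c<b }
    pick (selected a) ordered      x≡ y≡ = a , λ
      { zero       c c≡ a<c → <-irrefl (cong toℕ (same-selected x≡ c≡)) a<c
      ; (suc zero) c c≡ _   → not-selected {i} {suc zero} y≡ c≡ }
    pick (selected a) (selected b) x≡ y≡ = a , λ
      { zero       c c≡ a<c → <-irrefl (cong toℕ (same-selected x≡ c≡)) a<c
      ; (suc zero) c c≡ c<a →
          <-irrefl (cong toℕ (sym (same-selected y≡ c≡))) (<-≤-trans c<a (ordered-values (order-hit i (inject₁ a)))) }
      where
      both-selected : ∀ h → ∃[ c ] R i h ≡ select i h c
      both-selected zero       = a , x≡
      both-selected (suc zero) = b , y≡
      ordered-values : Has (_≡ order i (inject₁ a)) ⊎ Has (Hits i (Avoids n (toℕ (inject₁ a)))) → toℕ a ≤ toℕ b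
      ordered-values (inj₁ has)
        with () ← trans (sym (proj₂ (both-selected (half (order i (inject₁ a)))))) (tag-representative _ has)
      ordered-values (inj₂ has) with has-select {P = Avoids n (toℕ (inject₁ a))} has
      ... | zero , c , c≡ , c<a =
        contradiction (subst (toℕ c <_) (toℕ-inject₁ a) c<a) (<-irrefl (cong toℕ (same-selected c≡ x≡)))
      ... | suc zero , c , c≡ , a≤c =
        subst₂ _≤_ (toℕ-inject₁ a) (cong toℕ (same-selected c≡ y≡)) a≤c

  -- Elements of D are representatives, and these are points or order vertices.
  no-pair : ∀ i j u v → ¬ Has (_≡ pair i j u v)
  no-pair i j u v has = absurd (shape i zero) (tag-representative _ has)
    where
    absurd : ∀ {x} → Shape i zero x → x ≢ pair i j u v
    absurd (selected a) ()
    absurd ordered      ()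

  -- If they were nonadjacent, their pair vertex would have to be in D or dominated from block i or
  -- j, and all three are ruled out.
  adjacent : ∀ {i j} → toℕ i < toℕ j → Adj G (proj₁ (unhit i)) (proj₁ (unhit j))
  adjacent {i} {j} i<j with unhit i | unhit j
  ... | u , u-unhit | v , v-unhit with adj G u v in nonadjacent
  ...   | true  = tt
  ...   | false with pair-hit i j u v i<j nonadjacent
  ...     | inj₁ has = no-pair i j u v has
  ...     | inj₂ (inj₁ has) = let (h , a , eq , m) = has-select {P = Misses n (toℕ u)} has in u-unhit h a eq m
  ...     | inj₂ (inj₂ has) = let (h , a , eq , m) = has-select {P = Misses n (toℕ v)} has in v-unhit h a eq m

  dominating⇒sequence : CliqueSequence G k
  dominating⇒sequence = proj₁ ∘ unhit , λ {i} {j} i≢j → pairwise i≢j (<-cmp (toℕ i) (toℕ j))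
    where
    pairwise : ∀ {i j} → i ≢ j → Tri (toℕ i < toℕ j) (toℕ i ≡ toℕ j) (toℕ j < toℕ i) →
      Adj G (proj₁ (unhit i)) (proj₁ (unhit j))
    pairwise i≢j (tri< i<j _ _) = adjacent i<j
    pairwise i≢j (tri≈ _ i≡j _) = contradiction (toℕ-injective i≡j) i≢j
    pairwise i≢j (tri> _ _ j<i) = subst T (adj-sym G _ _) (adjacent j<i)

dominating⇒clique : ∀ {n} (G : Graph n) k → DominatingSet G k → ∃[ S ] ∣ S ∣ ≡ k × IsClique G S
dominating⇒clique {suc m} G k (D , ∣D∣≡2k , dominating) =
  sequence⇒clique G k (dominating⇒sequence G k D ∣D∣≡2k dominating)
-- For an empty `G` only the k order vertices exist, too few for 2 k elements unless k = 0; then the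
-- empty clique answers.
dominating⇒clique {zero}  G k (D , ∣D∣≡2k , _) with halve 2k≤k
  where
  2k≤k : k * 2 ≤ k
  2k≤k = subst₂ _≤_ ∣D∣≡2k (size-vertices-0 k) (∣p∣≤n D)
... | refl = Vec.[] , refl , λ ()

clique⇒dominating : ∀ {n} (G : Graph n) k → (∃[ S ] ∣ S ∣ ≡ k × IsClique G S) → DominatingSet G k
clique⇒dominating G k S = let (a , adjacent) = clique⇒sequence G k S in sequence⇒dominating G k a adjacent

-- The output of the reduction

positive : ℕ → Bool
positive zero    = false
positive (suc _) = true

-- Positive iff the boxes are disjoint: on every track one of the two truncated differences must be
-- positive. This makes adjacency an expression of the loop language.
gap : Box → Box → ℕ
gap b c = side zero * (side (suc zero) * side (suc (suc zero)))
  where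
  side : Fin Tracks → ℕ
  side t = (proj₁ (c t) ∸ proj₂ (b t)) + (proj₁ (b t) ∸ proj₂ (c t))

∸-positive : ∀ x y → T (positive (x ∸ y)) → y < x
∸-positive (suc x) zero    _ = z<s
∸-positive (suc x) (suc y) p = s<s (∸-positive x y p)

positive-∸ : ∀ {x y} → y < x → T (positive (x ∸ y))
positive-∸ {suc x} {zero}  _ = tt
positive-∸ {suc x} {suc y} h = positive-∸ (s<s⁻¹ h)

positive-+ : ∀ x y → T (positive (x + y)) → T (positive x) ⊎ T (positive y)
positive-+ zero    y p = inj₂ p
positive-+ (suc x) y p = inj₁ tt

+-positive : ∀ x y → T (positive x) ⊎ T (positive y) → T (positive (x + y))
+-positive (suc x) y       _        = tt
+-positive zero    y       (inj₂ p) = p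

positive-* : ∀ x y → T (positive (x * y)) → T (positive x) × T (positive y)
positive-* (suc x) (suc y) _ = tt , tt
positive-* (suc x) zero    p with () ← subst (T ∘ positive) (*-zeroʳ x) p

*-positive : ∀ x y → T (positive x) → T (positive y) → T (positive (x * y))
*-positive (suc x) (suc y) _ _ = tt

gap⇒disjoint : ∀ b c → T (positive (gap b c)) → Disjoint b c
gap⇒disjoint b c p = λ
  { zero → side zero (proj₁ (positive-* _ _ p))
  ; (suc zero) → side (suc zero) (proj₁ (positive-* _ _ (proj₂ (positive-* (separation zero) _ p))))
  ; (suc (suc zero)) → side (suc (suc zero))
      (proj₂ (positive-* (separation (suc zero)) _ (proj₂ (positive-* (separation zero) _ p)))) }
  where
  separation : Fin Tracks → ℕ
  separation t = (proj₁ (c t) ∸ proj₂ (b t)) + (proj₁ (b t) ∸ proj₂ (c t))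
  side : ∀ t → T (positive (separation t)) → proj₂ (b t) < proj₁ (c t) ⊎ proj₂ (c t) < proj₁ (b t)
  side t q = Data.Sum.map (∸-positive _ _) (∸-positive _ _) (positive-+ (proj₁ (c t) ∸ proj₂ (b t)) _ q)

disjoint⇒gap : ∀ b c → Disjoint b c → T (positive (gap b c))
disjoint⇒gap b c d = *-positive _ _ (side zero) (*-positive _ _ (side (suc zero)) (side (suc (suc zero))))
  where
  side : ∀ t → T (positive ((proj₁ (c t) ∸ proj₂ (b t)) + (proj₁ (b t) ∸ proj₂ (c t))))
  side t = +-positive (proj₁ (c t) ∸ proj₂ (b t)) _ (Data.Sum.map positive-∸ positive-∸ (d t))

T-injective : ∀ {a b} → (T a → T b) → (T b → T a) → a ≡ b
T-injective {true}  {true}  _ _ = refl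
T-injective {false} {false} _ _ = refl
T-injective {true}  {false} f _ with () ← f tt
T-injective {false} {true}  _ g with () ← g tt

adj-gap : ∀ {n} (G : Graph n) k x y →
  adj (reducedGraph G k) x y ≡ positive (gap (box G k (vertex G k x)) (box G k (vertex G k y)))
adj-gap G k x y = T-injective
  (disjoint⇒gap _ _ ∘ adjacent⇒apart G k x y) (apart⇒adjacent G k x y ∘ gap⇒disjoint _ _)

bitAt-row : ∀ {n} (f : Fin n → Bool) v rest → bitAt (tabulate (bit ∘ f) ++ rest) (toℕ v) ≡ value (f v)
bitAt-row f zero    rest = refl
bitAt-row f (suc v) rest = bitAt-row (f ∘ suc) v rest

bitAt-skip : ∀ {n} (f : Fin n → Symbol) x rest → bitAt (tabulate f ++ rest) (n + x) ≡ bitAt rest x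
bitAt-skip {zero}  f x rest = refl
bitAt-skip {suc n} f x rest = bitAt-skip (f ∘ suc) x rest

bitAt-matrix : ∀ {m n} (A : Fin m → Fin n → Bool) u v →
  bitAt (concat (tabulate λ u → tabulate λ v → bit (A u v))) (toℕ u * n + toℕ v) ≡ value (A u v)
bitAt-matrix A zero v = bitAt-row (A zero) v _
bitAt-matrix {suc m} {n} A (suc u) v = trans
  (cong (bitAt (concat (tabulate λ u → tabulate λ v → bit (A u v)))) (+-assoc n (toℕ u * n) (toℕ v)))
  (trans (bitAt-skip (bit ∘ A zero) (toℕ u * n + toℕ v) _) (bitAt-matrix (A ∘ suc) u v))

-- Box expressions and the printing program

BoxExp : ℕ → Set
BoxExp m = Fin Tracks → Exp m × Exp m

⟦_⟧ᵇ : ∀ {m} → BoxExp m → Word → (Fin m → ℕ) → Box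
⟦ b ⟧ᵇ M γ t = ⟦ proj₁ (b t) ⟧ M γ , ⟦ proj₂ (b t) ⟧ M γ

rename : ∀ {m m′} → (Fin m → Fin m′) → Exp m → Exp m′
rename f (var i)      = var (f i)
rename f (lit x)      = lit x
rename f (bin o e e′) = bin o (rename f e) (rename f e′)
rename f (at e)       = at (rename f e)

renameBox : ∀ {m m′} → (Fin m → Fin m′) → BoxExp m → BoxExp m′
renameBox f b t = rename f (proj₁ (b t)) , rename f (proj₂ (b t))

rename-correct : ∀ {m m′ M γ γ′} {f : Fin m → Fin m′} (e : Exp m) → (∀ i → γ′ (f i) ≡ γ i) →
  ⟦ rename f e ⟧ M γ′ ≡ ⟦ e ⟧ M γ
rename-correct (var i)      eq = eq i
rename-correct (lit x)      eq = refl
rename-correct (bin o e e′) eq = cong₂ (apply o) (rename-correct e eq) (rename-correct e′ eq)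
rename-correct {M = M} (at e) eq = cong (bitAt M) (rename-correct e eq)

module _ {m : ℕ} (K N : Exp m) where

  width stride : Exp m
  width  = lit 1 ⊹ N
  stride = width ⊹ width

  selectExp : Exp m → Exp m → Exp m → BoxExp m
  selectExp i h a = tracks (p , p) (p , p) (p , p)
    where p = i ⊛ stride ⊹ (h ⊛ width ⊹ (lit 1 ⊹ a))

  orderExp : Exp m → Exp m → BoxExp m
  orderExp i o = tracks (lit 0 , i ⊛ stride)
    (i ⊛ stride ⊹ (lit 1 ⊹ o) , i ⊛ stride ⊹ (width ⊹ o))
    (i ⊛ stride ⊹ stride , K ⊛ stride ⊹ K ⊛ stride)

  pairExp : Exp m → Exp m → Exp m → Exp m → BoxExp m
  pairExp i j u v =
    tracks (lit 0 , s ⊛ p) (s ⊛ (p ⊹ width) , s ⊛ q)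
      (q ⊹ width ⊹ (lit 1 ⊖ s) ⊛ (K ⊛ stride) , K ⊛ stride ⊹ K ⊛ stride)
    where
    s = (lit 1 ⊖ (lit 1 ⊖ (j ⊖ i))) ⊛ (lit 1 ⊖ at (u ⊛ N ⊹ v))
    p = i ⊛ stride ⊹ (lit 1 ⊹ u)
    q = j ⊛ stride ⊹ (lit 1 ⊹ v)

lift : ∀ {m} d → Exp m → Exp (d + m)
lift d = rename (d ↑ʳ_)

-- The body is run for each vertex in turn; it gets the embedding of the
-- variables in scope and the box of the vertex.
forVertices : ∀ {m} → (K N : Exp m) →
  (∀ {m′} → (Fin m → Fin m′) → BoxExp m′ → Prog m′) → Prog m
forVertices K N body =
  loop K (loop (lit 2) (loop (lift 2 N)
    (body (3 ↑ʳ_) (selectExp (lift 3 K) (lift 3 N) (var #2) (var #1) (var #0)))))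
  ∙ loop K (loop (lit 1 ⊹ lift 1 N)
    (body (2 ↑ʳ_) (orderExp (lift 2 K) (lift 2 N) (var #1) (var #0))))
  ∙ loop K (loop (lift 1 K) (loop (lift 2 N) (loop (lift 3 N)
    (body (4 ↑ʳ_) (pairExp (lift 4 K) (lift 4 N) (var (suc #2)) (var #2) (var #1) (var #0))))))

record Prints {m : ℕ} (P : Prog m) (M : Word) (ρ : Vec ℕ m) (w : Word) : Set where
  constructor prints
  field
    printed : run P M ρ ≡ w

open Prints

respell : ∀ {m M ρ w w′} {P : Prog m} → w ≡ w′ → Prints P M ρ w → Prints P M ρ w′
respell refl p = p

infixr 4 _∙ₚ_
_∙ₚ_ : ∀ {m M ρ w w′} {P Q : Prog m} →
  Prints P M ρ w → Prints Q M ρ w′ → Prints (P ∙ Q) M ρ (w ++ w′)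
prints p ∙ₚ prints q = prints (cong₂ _++_ p q)

prints-loop : ∀ {m M ρ v} {e : Exp m} {P} {w : Fin v → Word} → ⟦ e ⟧ M (lookup ρ) ≡ v →
  (∀ i → Prints P M (toℕ i Vec.∷ ρ) (w i)) → Prints (loop e P) M ρ (concat (tabulate w))
prints-loop refl p = prints (cong concat (tabulate-cong (printed ∘ p)))

matrix : ∀ {n} → Graph n → Word
matrix G = concat (tabulate λ u → tabulate λ v → bit (adj G u v))

module _ {m : ℕ} (K N : Exp m) (M : Word) (γ : Fin m → ℕ) where

  selectExp-box : ∀ i h a t → ⟦ selectExp K N i h a ⟧ᵇ M γ t ≡
    selectBox (⟦ N ⟧ M γ) (⟦ i ⟧ M γ) (⟦ h ⟧ M γ) (⟦ a ⟧ M γ) t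
  selectExp-box i h a = λ { zero → refl ; (suc zero) → refl ; (suc (suc zero)) → refl }

  orderExp-box : ∀ i o t → ⟦ orderExp K N i o ⟧ᵇ M γ t ≡
    orderBox (⟦ N ⟧ M γ) (⟦ K ⟧ M γ) (⟦ i ⟧ M γ) (⟦ o ⟧ M γ) t
  orderExp-box i o = λ { zero → refl ; (suc zero) → refl ; (suc (suc zero)) → refl }

  pairExp-box : ∀ i j u v t → ⟦ pairExp K N i j u v ⟧ᵇ M γ t ≡
    pairBox (⟦ N ⟧ M γ) (⟦ K ⟧ M γ)
      (active (⟦ i ⟧ M γ) (⟦ j ⟧ M γ) (bitAt M (⟦ u ⟧ M γ * ⟦ N ⟧ M γ + ⟦ v ⟧ M γ)))
      (⟦ i ⟧ M γ) (⟦ j ⟧ M γ) (⟦ u ⟧ M γ) (⟦ v ⟧ M γ) t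
  pairExp-box i j u v = λ { zero → refl ; (suc zero) → refl ; (suc (suc zero)) → refl }

module _ {n : ℕ} (G : Graph n) (k : ℕ) where

  Denotes : ∀ {m} → BoxExp m → Vec ℕ m → Vertex k n → Set
  Denotes b ρ x = ∀ t → ⟦ b ⟧ᵇ (matrix G) (lookup ρ) t ≡ box G k x t

  module _ {m : ℕ} {K N : Exp m} {ρ : Vec ℕ m}
    (K≡k : ⟦ K ⟧ (matrix G) (lookup ρ) ≡ k) (N≡n : ⟦ N ⟧ (matrix G) (lookup ρ) ≡ n)
    (body : ∀ {m′} → (Fin m → Fin m′) → BoxExp m′ → Prog m′) (w : Vertex k n → Word)
    (prints-body : ∀ x {m′} (f : Fin m → Fin m′) b ρ′ → (∀ i → lookup ρ′ (f i) ≡ lookup ρ i) →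
      Denotes b ρ′ x → Prints (body f b) (matrix G) ρ′ (w x)) where

    private
      M = matrix G

      lift-K : ∀ {d γ} → (∀ i → γ (d ↑ʳ i) ≡ lookup ρ i) → ⟦ lift d K ⟧ M γ ≡ k
      lift-K eq = trans (rename-correct K eq) K≡k

      lift-N : ∀ {d γ} → (∀ i → γ (d ↑ʳ i) ≡ lookup ρ i) → ⟦ lift d N ⟧ M γ ≡ n
      lift-N eq = trans (rename-correct N eq) N≡n

      prints-select : ∀ i h a → let ρ′ = toℕ a Vec.∷ toℕ h Vec.∷ toℕ i Vec.∷ ρ in
        Prints (body (3 ↑ʳ_) (selectExp (lift 3 K) (lift 3 N) (var #2) (var #1) (var #0))) M ρ′ (w (select i h a))
      prints-select i h a = prints-body (select i h a) _ _ ρ′ (λ _ → refl) λ t →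
        trans (selectExp-box (lift 3 K) (lift 3 N) M (lookup ρ′) (var #2) (var #1) (var #0) t)
          (cong (λ n → selectBox n (toℕ i) (toℕ h) (toℕ a) t) (lift-N {3} {lookup ρ′} λ _ → refl))
        where ρ′ = toℕ a Vec.∷ toℕ h Vec.∷ toℕ i Vec.∷ ρ

      prints-order : ∀ i o → let ρ′ = toℕ o Vec.∷ toℕ i Vec.∷ ρ in
        Prints (body (2 ↑ʳ_) (orderExp (lift 2 K) (lift 2 N) (var #1) (var #0))) M ρ′ (w (order i o))
      prints-order i o = prints-body (order i o) _ _ ρ′ (λ _ → refl) λ t →
        trans (orderExp-box (lift 2 K) (lift 2 N) M (lookup ρ′) (var #1) (var #0) t)
          (cong₂ (λ n k → orderBox n k (toℕ i) (toℕ o) t)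
            (lift-N {2} {lookup ρ′} λ _ → refl) (lift-K {2} {lookup ρ′} λ _ → refl))
        where ρ′ = toℕ o Vec.∷ toℕ i Vec.∷ ρ

      prints-pair : ∀ i j u v → let ρ′ = toℕ v Vec.∷ toℕ u Vec.∷ toℕ j Vec.∷ toℕ i Vec.∷ ρ in
        Prints (body (4 ↑ʳ_) (pairExp (lift 4 K) (lift 4 N) (var (suc #2)) (var #2) (var #1) (var #0))) M ρ′
          (w (pair i j u v))
      prints-pair i j u v = prints-body (pair i j u v) _ _ ρ′ (λ _ → refl) λ t →
        trans (pairExp-box (lift 4 K) (lift 4 N) M (lookup ρ′) (var (suc #2)) (var #2) (var #1) (var #0) t)
          (trans
            (cong₂ (λ n k → box′ n k (bitAt M (toℕ u * n + toℕ v)) t)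
              (lift-N {4} {lookup ρ′} λ _ → refl) (lift-K {4} {lookup ρ′} λ _ → refl))
            (cong (λ e → box′ n k e t) (bitAt-matrix (adj G) u v)))
        where
        ρ′ = toℕ v Vec.∷ toℕ u Vec.∷ toℕ j Vec.∷ toℕ i Vec.∷ ρ
        box′ : ℕ → ℕ → ℕ → Box
        box′ n k e = pairBox n k (active (toℕ i) (toℕ j) e) (toℕ i) (toℕ j) (toℕ u) (toℕ v)

    opaque
      unfolding vertices

      -- The factors of `vertices`, unfolded here, match the nested loops one by one.
      prints-forVertices : Prints (forVertices K N body) M ρ (each (vertices k n) w)
      prints-forVertices =
        (prints-loop K≡k λ i → prints-loop refl λ h → prints-loop (lift-N {2} λ _ → refl) λ a → prints-select i h a)
        ∙ₚ (prints-loop K≡k λ i → prints-loop (cong suc (lift-N {1} λ _ → refl)) λ o → prints-order i o)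
        ∙ₚ (prints-loop K≡k λ i → prints-loop (lift-K {1} λ _ → refl) λ j → prints-loop (lift-N {2} λ _ → refl) λ u →
            prints-loop (lift-N {3} λ _ → refl) λ v → prints-pair i j u v)

prints-numeral : ∀ {m M ρ x} (e : Exp m) → ⟦ e ⟧ M (lookup ρ) ≡ x → Prints (numeral e) M ρ (unary x)
prints-numeral {M = M} {ρ} e refl = prints (run-numeral e M ρ)

printBox : ∀ {m} → BoxExp m → Prog m
printBox b = ends zero ∙ ends (suc zero) ∙ ends (suc (suc zero))
  where ends = λ t → numeral (proj₁ (b t)) ∙ numeral (proj₂ (b t))

prints-box : ∀ {m M ρ} (b : BoxExp m) {c} (valid : Valid c) → (∀ t → ⟦ b ⟧ᵇ M (lookup ρ) t ≡ c t) →
  Prints (printBox b) M ρ (encodeThreeTrackInterval (toIntervals c valid))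
prints-box {M = M} {ρ} b {c} valid b≡c =
  -- The encoding is a `concat`, which leaves an empty word at its end.
  prints (trans (printed (ends zero ∙ₚ ends (suc zero) ∙ₚ ends (suc (suc zero))))
    (cong (λ w → word zero ++ word (suc zero) ++ w) (sym (++-identityʳ (word (suc (suc zero)))))))
  where
  word : Fin Tracks → Word
  word t = encodeInterval (toIntervals c valid t)
  ends : ∀ t → Prints (numeral (proj₁ (b t)) ∙ numeral (proj₂ (b t))) M ρ (word t)
  ends t = prints-numeral (proj₁ (b t)) (cong proj₁ (b≡c t)) ∙ₚ prints-numeral (proj₂ (b t)) (cong proj₂ (b≡c t))

gapExp : ∀ {m} → BoxExp m → BoxExp m → Exp m
gapExp b c = side zero ⊛ (side (suc zero) ⊛ side (suc (suc zero)))
  where side = λ t → (proj₁ (c t) ⊖ proj₂ (b t)) ⊹ (proj₁ (b t) ⊖ proj₂ (c t))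

gap-cong : ∀ {b b′ c c′} → (∀ t → b t ≡ b′ t) → (∀ t → c t ≡ c′ t) → gap b c ≡ gap b′ c′
gap-cong b≡ c≡ = cong₂ _*_ (side zero) (cong₂ _*_ (side (suc zero)) (side (suc (suc zero))))
  where side = λ t → cong₂ (λ x y → (proj₁ y ∸ proj₂ x) + (proj₁ x ∸ proj₂ y)) (b≡ t) (c≡ t)

printAdjacency : ∀ {m} → BoxExp m → BoxExp m → Prog m
printAdjacency b c = ifPos (gapExp b c) (emit (bit true)) (emit (bit false))

prints-adjacency : ∀ {m M ρ} (b c : BoxExp m) {b′ c′} →
  (∀ t → ⟦ b ⟧ᵇ M (lookup ρ) t ≡ b′ t) → (∀ t → ⟦ c ⟧ᵇ M (lookup ρ) t ≡ c′ t) →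
  Prints (printAdjacency b c) M ρ (bit (positive (gap b′ c′)) ∷ [])
prints-adjacency {M = M} {ρ} b c b≡ c≡ = prints (trans (choose-positive (⟦ gapExp b c ⟧ M (lookup ρ)))
  (cong (λ x → bit (positive x) ∷ []) (gap-cong b≡ c≡)))
  where
  choose-positive : ∀ x → choose x (bit true ∷ []) (bit false ∷ []) ≡ bit (positive x) ∷ []
  choose-positive zero    = refl
  choose-positive (suc x) = refl

printRow : ∀ {m} → Exp m → Exp m → BoxExp m → Prog m
printRow K N b = forVertices K N λ f c → printAdjacency (renameBox f b) c

reduction : Prog 2
reduction = numeral (K ⊛ lit 2)
  ∙ ((forVertices K O (λ _ _ → emit (bit true)) ∙ emit sep)
      ∙ forVertices K O (λ f → printRow (rename f K) (rename f O)))
  ∙ forVertices K O (λ _ → printBox)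
  where
  K O : Exp 2
  K = var #1
  O = var #0

concat-singletons : ∀ {A : Set} {n} (f : Fin n → A) → concat (tabulate λ i → f i ∷ []) ≡ tabulate f
concat-singletons {n = zero}  f = refl
concat-singletons {n = suc n} f = cong (f zero ∷_) (concat-singletons (f ∘ suc))

instanceOf : CliqueInstance → Co3TrackInstance
instanceOf x = record
  { graph          = reducedGraph graph k
  ; representation = family graph k
  ; represents     = λ _ _ → refl
  ; k              = k * 2
  }
  where open CliqueInstance x using (graph; k)

reduction-correct : ∀ {n} (G : Graph n) k → Prints reduction (matrix G) (n Vec.∷ k Vec.∷ Vec.[])
  (ParameterizedProblem.encode k-DominatingSet-Co3Track (instanceOf record { graph = G ; k = k }))
reduction-correct {n} G k = prints-numeral (var #1 ⊛ lit 2) refl ∙ₚ (order-part ∙ₚ matrix-part) ∙ₚ boxes-part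
  where
  M = matrix G
  ρ = n Vec.∷ k Vec.∷ Vec.[]
  V = vertices k n

  each-vertex : ∀ {P w} → Prints P M ρ (each V w) → Prints P M ρ (concat (tabulate (w ∘ item V)))
  each-vertex {w = w} = respell (sym (each-item V w))

  order-part : Prints (forVertices (var #1) (var #0) (λ _ _ → emit (bit true)) ∙ emit sep) M ρ (unary (size V))
  order-part = respell (concat-replicate (size V) (bit true))
    (each-vertex (prints-forVertices G k {K = var #1} {var #0} refl refl (λ _ _ → emit (bit true)) (λ _ → bit true ∷ [])
      λ _ _ _ _ _ _ → prints refl)) ∙ₚ prints refl

  row : Vertex k n → Vertex k n → Word
  row x y = bit (positive (gap (box G k x) (box G k y))) ∷ []

  prints-row : ∀ x {m} {K N : Exp m} {b ρ} → ⟦ K ⟧ M (lookup ρ) ≡ k → ⟦ N ⟧ M (lookup ρ) ≡ n →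
    Denotes G k b ρ x → Prints (printRow K N b) M ρ (each V (row x))
  prints-row x {K = K} {N} {b} {ρ} K≡k N≡n b≡x = prints-forVertices G k {_} {K} {N} {ρ} K≡k N≡n
    (λ f c → printAdjacency (renameBox f b) c) (row x)
    λ y f c ρ′ f≡ c≡y → prints-adjacency (renameBox f b) c
      (λ t → trans (cong₂ _,_ (rename-correct (proj₁ (b t)) f≡) (rename-correct (proj₂ (b t)) f≡)) (b≡x t)) c≡y

  row-adjacency : ∀ x → each V (row (vertex G k x)) ≡ tabulate λ y → bit (adj (reducedGraph G k) x y)
  row-adjacency x = trans (sym (each-item V (row (vertex G k x))))
    (trans (concat-singletons _) (tabulate-cong λ y → cong bit (sym (adj-gap G k x y))))

  matrix-part : Prints (forVertices (var #1) (var #0) (λ f → printRow (rename f (var #1)) (rename f (var #0)))) M ρ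
    (concat (tabulate λ x → tabulate λ y → bit (adj (reducedGraph G k) x y)))
  matrix-part = respell (cong concat (tabulate-cong row-adjacency))
    (each-vertex (prints-forVertices G k {K = var #1} {var #0} refl refl
      (λ f → printRow (rename f (var #1)) (rename f (var #0))) (λ x → each V (row x))
      λ x f b ρ′ f≡ b≡x → prints-row x {b = b} (f≡ #1) (f≡ #0) b≡x))

  boxes-part : Prints (forVertices (var #1) (var #0) (λ _ → printBox)) M ρ
    (concat (tabulate λ x → encodeThreeTrackInterval (family G k x)))
  boxes-part = each-vertex (prints-forVertices G k {K = var #1} {var #0} refl refl (λ _ → printBox)
    (λ x → encodeThreeTrackInterval (intervals G k x)) λ x f b ρ′ _ b≡x → prints-box b (box-valid G k x) b≡x)

-- Assembling the FPT reduction

suc-computable : Computable suc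
suc-computable = 0 , push zero (bit true) , λ n → 1 , Vec.[] , run-push

theorem2 : W[1]-Hard k-DominatingSet-Co3Track
theorem2 = fromTransducer (transducer reduction)
  where
  open ParameterizedProblem using (param; encode) renaming (size to inputSize)
  fromTransducer : ∃[ m ] Σ[ p ∈ Program (suc m) ] ∃[ d ] Transduces p d reduction →
    FPTReduction k-Clique k-DominatingSet-Co3Track
  fromTransducer (m , p , d , transduces) = record
    { reduce       = instanceOf
    ; equivalent   = λ x → let open CliqueInstance x using (graph; k) in
        mk⇔ (clique⇒dominating graph k) (dominating⇒clique graph k)
    ; h            = _* 2
    ; h-computable = doubling-computable
    ; param-bound  = λ _ → ≤-refl
    -- The time is at most s ^ d already, so a computable function with positive values is enough.
    ; g            = suc
    ; g-computable = suc-computable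
    ; exponent     = d
    ; stacks       = m
    ; program      = p
    ; runs         = runs
    }
    where
    runs : ∀ x → ∃[ t ] t ≤ suc (param k-Clique x) * inputSize k-Clique x ^ d
      × Outputs p (encode k-Clique x) (encode k-DominatingSet-Co3Track (instanceOf x)) t
    runs x = t , ≤-trans (bound t-power) (m≤m+n _ _) ,
      subst (λ w → Outputs p (encode k-Clique x) w t) (printed (reduction-correct graph k)) outputs
      where
      open CliqueInstance x using (graph; k) renaming (order to N)
      M = matrix graph
      length-unary : ∀ a → length (unary a) ≡ suc a
      length-unary a = trans (length-++ (tally a)) (trans (cong (_+ 1) (length-replicate a)) (+-comm a 1))
      s≡ : inputSize k-Clique x ≡ suc k + (suc N + length M)
      s≡ = trans (length-++ (unary k)) (cong₂ _+_ (length-unary k)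
        (trans (length-++ (unary N)) (cong (_+ length M) (length-unary N))))
      ≤s : ∀ {a} → a ≤ suc k + (suc N + length M) → a ≤ inputSize k-Clique x
      ≤s a≤ = ≤-trans a≤ (≤-reflexive (sym s≡))
      transduced = transduces k N M
        -- The separators of the two unary numbers make the input at least 2 symbols long.
        (≤s (s≤s (≤-trans (s≤s z≤n) (m≤n+m (suc N + length M) k))))
        (≤s (≤-trans (n≤1+n k) (m≤m+n (suc k) (suc N + length M))))
        (≤s (≤-trans (≤-trans (n≤1+n N) (m≤m+n (suc N) (length M))) (m≤n+m (suc N + length M) (suc k))))
        (≤s (≤-trans (m≤n+m (length M) (suc N)) (m≤n+m (suc N + length M) (suc k))))
      t       = proj₁ transduced
      t-power = proj₁ (proj₂ transduced)
      outputs = proj₂ (proj₂ transduced)
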